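{- Let $\overline{p}(n)$ denote the number of overpartitions of $n$. For all $\alpha\ge1$, $n\ge0$ and $i\in\{1,2\}$: (1) $\overline{p}(4\cdot3^{2\alpha}n+(4i+3)\cdot3^{2\alpha-1})\equiv0\pmod{2^2}$; (2) $\overline{p}(4\cdot3^{2\alpha}n+(4i+6)\cdot3^{2\alpha-1})\equiv0\pmod{2^3}$; (3) $\overline{p}(4\cdot3^{4\alpha}n+(4i+9)\cdot3^{4\alpha-1})\equiv0\pmod{2^4}$.
   Context: An overpartition of $n$ is a partition of $n$ in which the first occurrence of each distinct part may be overlined. Its generating function is $\sum_{n\ge0}\overline{p}(n)q^n=\prod_{n\ge1}\frac{1+q^n}{1-q^n}=\prod_{n\ge1}\frac{1-q^{2n}}{(1-q^n)^2}$. -}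

module Defs where

open import Data.Bool using (Bool; true; false)
open import Data.List using (List; []; _∷_; map; length; filter; upTo;
  cartesianProduct; cartesianProductWith)
open import Data.List.Membership.Propositional using (_∈_)
open import Data.List.Membership.Propositional.Properties
  using (∈-cartesianProduct⁺; ∈-cartesianProductWith⁺; ∈-cartesianProductWith⁻;
         ∈-upTo⁺; ∈-filter⁺; ∈-filter⁻)
open import Data.List.Properties using (∷-injective)
open import Data.List.Relation.Unary.All as All using (All; []; _∷_)
open import Data.List.Relation.Unary.AllPairs using ([]; _∷_)
open import Data.List.Relation.Unary.Any using (here; there)
open import Data.List.Relation.Unary.Linked using (Linked; linked?)
open import Data.List.Relation.Unary.Unique.Propositional using (Unique)
open import Data.List.Relation.Unary.Unique.Propositional.Properties
  using (upTo⁺; cartesianProduct⁺; cartesianProductWith⁺; filter⁺)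
open import Data.Nat using (ℕ; zero; suc; _≤_; _<_; _≤?_; _<?_; _≟_; z≤n; s≤s)
open import Data.Nat.Properties using (≤-trans; ≤-reflexive; m≤m+n; m≤n+m; +-mono-≤)
open import Data.Nat.ListAction using (sum)
open import Data.Product using (_×_; _,_; proj₁; proj₂)
open import Function.Bundles using (_⇔_; mk⇔)
open import Relation.Binary.Definitions using (Decidable)
open import Relation.Binary.PropositionalEquality using (_≡_; _≢_; refl)
open import Relation.Nullary.Decidable using (Dec; map′; _×-dec_)

-- A part with its mark; `true` means overlined.
Part : Set
Part = ℕ × Bool

size : Part → ℕ
size = proj₁

-- `p ⊵ q`: q may come immediately after p.  Parts are listed in weakly
-- decreasing order, so equal parts are adjacent and q is the first occurrence
-- of its size exactly when the preceding part is strictly larger.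
_⊵_ : Part → Part → Set
(a , _) ⊵ (b , false) = b ≤ a
(a , _) ⊵ (b , true)  = b < a

record IsOverpartition (n : ℕ) (ps : List Part) : Set where
  constructor isOverpartition
  field
    positive : All (λ p → 0 < size p) ps
    linked   : Linked _⊵_ ps
    total    : sum (map size ps) ≡ n

_⊵?_ : Decidable _⊵_
(a , _) ⊵? (b , false) = b ≤? a
(a , _) ⊵? (b , true)  = b <? a

isOverpartition? : ∀ n ps → Dec (IsOverpartition n ps)
isOverpartition? n ps =
  map′ (λ (p , l , t) → isOverpartition p l t)
       (λ (isOverpartition p l t) → p , l , t)
       (All.all? (λ p → 0 <? size p) ps ×-dec linked? _⊵?_ ps
         ×-dec (sum (map size ps) ≟ n))

partsUpTo : ℕ → List Part
partsUpTo n = cartesianProduct (upTo (suc n)) (false ∷ true ∷ [])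

-- All lists of length at most l with entries in ps.
listsUpTo : List Part → ℕ → List (List Part)
listsUpTo ps zero    = [] ∷ []
listsUpTo ps (suc l) = [] ∷ cartesianProductWith _∷_ ps (listsUpTo ps l)

-- An overpartition of n has at most n parts, each of size at most n; the lemmas
-- below show that this list contains every overpartition of n exactly once.
overpartitions : ℕ → List (List Part)
overpartitions n = filter (isOverpartition? n) (listsUpTo (partsUpTo n) n)

p̄ : ℕ → ℕ
p̄ n = length (overpartitions n)

∈-listsUpTo : ∀ {ps} l {xs} → length xs ≤ l → All (_∈ ps) xs → xs ∈ listsUpTo ps l
∈-listsUpTo zero    {[]}    _       _         = here refl
∈-listsUpTo (suc l) {[]}    _       _         = here refl
∈-listsUpTo (suc l) {_ ∷ _} (s≤s m) (x∈ ∷ as) =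
  there (∈-cartesianProductWith⁺ _∷_ x∈ (∈-listsUpTo l m as))

listsUpTo-unique : ∀ {ps} l → Unique ps → Unique (listsUpTo ps l)
listsUpTo-unique zero    u = [] ∷ []
listsUpTo-unique {ps} (suc l) u =
  All.tabulate []≢ ∷ cartesianProductWith⁺ _∷_ ∷-injective u (listsUpTo-unique l u)
  where
  []≢ : ∀ {ys} → ys ∈ cartesianProductWith _∷_ ps (listsUpTo ps l) → [] ≢ ys
  []≢ ys∈ refl with ∈-cartesianProductWith⁻ _∷_ ps (listsUpTo ps l) ys∈
  ... | _ , _ , _ , _ , ()

∈-partsUpTo : ∀ {n} p → size p ≤ n → p ∈ partsUpTo n
∈-partsUpTo (a , b) a≤n = ∈-cartesianProduct⁺ (∈-upTo⁺ (s≤s a≤n)) (bool b)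
  where
  bool : ∀ b → b ∈ (false ∷ true ∷ [])
  bool false = here refl
  bool true  = there (here refl)

partsUpTo-unique : ∀ n → Unique (partsUpTo n)
partsUpTo-unique n =
  cartesianProduct⁺ (upTo⁺ (suc n)) (((λ ()) ∷ []) ∷ [] ∷ [])

length≤sum : ∀ {ps} → All (λ p → 0 < size p) ps → length ps ≤ sum (map size ps)
length≤sum []       = z≤n
length≤sum (p ∷ ps) = +-mono-≤ p (length≤sum ps)

sizes≤sum : ∀ {n} ps → sum (map size ps) ≤ n → All (λ p → size p ≤ n) ps
sizes≤sum []       _ = []
sizes≤sum (p ∷ ps) s =
  ≤-trans (m≤m+n (size p) _) s ∷ sizes≤sum ps (≤-trans (m≤n+m _ (size p)) s)

∈-overpartitions : ∀ n ps → ps ∈ overpartitions n ⇔ IsOverpartition n ps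
∈-overpartitions n ps = mk⇔
  (λ ps∈ → proj₂ (∈-filter⁻ (isOverpartition? n) {xs = listsUpTo (partsUpTo n) n} ps∈))
  complete
  where
  complete : IsOverpartition n ps → ps ∈ overpartitions n
  complete o@(isOverpartition pos _ tot) =
    ∈-filter⁺ (isOverpartition? n)
      (∈-listsUpTo n (≤-trans (length≤sum pos) (≤-reflexive tot))
        (All.map (λ {p} → ∈-partsUpTo p) (sizes≤sum ps (≤-reflexive tot))))
      o

overpartitions-unique : ∀ n → Unique (overpartitions n)
overpartitions-unique n =
  filter⁺ (isOverpartition? n) (listsUpTo-unique n (partsUpTo-unique n))

{-# OPTIONS --safe #-}

-- Let p be the generating function of p̄.  Gauss's identity
-- ∏ (1 - q^n)/(1 + q^n) = 1 + 2 ∑_{k≥1} (-1)^k q^(k²) gives, coefficientwise,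
-- p(n) = δ(n) - 2 ∑_{k≥1} (-1)^k p(n - k²).  If n is not a sum of two squares
-- (zero included), three uses of this recurrence have no δ-term and leave
-- p(n) = -8 ∑_{k,l,m} ± p(n - k² - l² - m²), so 8 ∣ p(n).  Modulo 2 the triple sum
-- counts representations n = k² + l² + m² by positive integers, and exchanging k
-- and l shows that this has the parity of the number R(n) of representations
-- n = 2x² + z².  When the exponent of 3 in n is odd, n is not a sum of two squares.
-- Finally let P(n) count the representations n = 2x² + z² with 3 ∤ x.  If 3 ∣ n then
-- R(9n) = P(9n) + R(n), while multiplication by the element 1 + √-2 of norm 3 gives
-- P(3n) = P(n); hence R(81n) ≡ R(n) and R(27m) = 2 P(3m) for 3 ∤ m.
module Submission where

open import Defs
open import Data.Bool using (true; false)
import Data.Bool.Properties as Bool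
open import Data.Empty using (⊥)
open import Data.Integer using (ℤ; +_; -[1+_])
import Data.Integer as Int
open import Data.Integer.Divisibility.Signed as ∣ℤ using () renaming (_∣_ to _∣ℤ_)
import Data.Integer.Properties as ℤₚ
import Data.Integer.Tactic.RingSolver as ℤ-Solver
open import Data.List
  using (List; []; _∷_; _++_; map; length; filter; applyDownFrom; cartesianProduct)
open import Data.List.Membership.Propositional using (_∈_)
open import Data.List.Membership.Propositional.Properties
  using (∈-∃++; ∈-++⁺ˡ; ∈-++⁺ʳ; ∈-++⁻; ∈-filter⁺; ∈-filter⁻; ∈-applyDownFrom⁺;
         ∈-applyDownFrom⁻; ∈-cartesianProduct⁺; ∈-cartesianProduct⁻)
open import Data.List.Properties
  using (length-++; filter-++; filter-accept; filter-reject; filter-all; filter-none; ∷-injectiveʳ)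
open import Data.List.Relation.Unary.All as All using (All; []; _∷_)
open import Data.List.Relation.Unary.AllPairs using ([]; _∷_)
open import Data.List.Relation.Unary.Any using (here; there)
open import Data.List.Relation.Unary.Linked as Linked using (Linked; [-]; linked?)
  renaming (_∷_ to _∷ˡ_)
open import Data.List.Relation.Unary.Unique.Propositional using (Unique)
import Data.List.Relation.Unary.Unique.Propositional.Properties as Unique
open import Data.Nat using (ℕ; zero; suc; _≤_; _<_; z≤n; s≤s)
import Data.Nat as Nat
import Data.Nat.Divisibility as ∣ℕ
open import Data.Nat.Induction using (<-wellFounded)
import Data.Nat.Properties as ℕₚ
import Data.Nat.Tactic.RingSolver as ℕ-Solver
open import Data.Product using (_×_; _,_; proj₁; proj₂; ∃; ∃₂)
import Data.Product.Properties as Product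
open import Data.Sum using (_⊎_; inj₁; inj₂; [_,_])
open import Function using (_∘_; _⇔_; mk⇔; Equivalence)
open import Induction.WellFounded using (Acc; acc)
open import Level using (0ℓ)
open import Relation.Binary.PropositionalEquality
  using (_≡_; _≢_; refl; sym; trans; cong; cong₂; subst; module ≡-Reasoning)
open import Relation.Nullary using (¬_; yes; no; contradiction)
open import Relation.Nullary.Decidable using (map′; _×-dec_; ¬?; from-no)
open import Relation.Unary using (Pred; Decidable)

-- Comparison of list lengths, and recurrences for overpartitions with bounded first part.

module Counting where
  open Nat using (_+_; _∸_)

  remove : ∀ {A : Set} {x y : A} us {vs} → x ∈ us ++ y ∷ vs → x ≢ y → x ∈ us ++ vs
  remove us x∈ x≢y with ∈-++⁻ us x∈
  ... | inj₁ x∈us         = ∈-++⁺ˡ x∈us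
  ... | inj₂ (here x≡y)   = contradiction x≡y x≢y
  ... | inj₂ (there x∈vs) = ∈-++⁺ʳ us x∈vs

  -- Pigeonhole by induction: the image of the head is deleted from `ys`, and injectivity keeps the
  -- images of the other entries in what remains. A relation can be read in both directions, which
  -- `length-bijective` exploits.
  length-injective : ∀ {A B : Set} (ρ : A → B → Set) →
    (∀ {x x′ y} → ρ x y → ρ x′ y → x ≡ x′) →
    ∀ {xs ys} → Unique xs → (∀ {x} → x ∈ xs → ∃ λ y → y ∈ ys × ρ x y) →
    length xs ≤ length ys
  length-injective ρ inj {[]}     _        _ = z≤n
  length-injective ρ inj {x ∷ xs} (x∉ ∷ u) f with f (here refl)
  ... | y , y∈ , ρxy with ∈-∃++ y∈
  ... | us , vs , refl = ℕₚ.≤-trans (s≤s (length-injective ρ inj u f′))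
    (ℕₚ.≤-reflexive (sym length-middle))
    where
    length-middle : length (us ++ y ∷ vs) ≡ suc (length (us ++ vs))
    length-middle = trans (length-++ us)
      (trans (ℕₚ.+-suc (length us) (length vs)) (cong suc (sym (length-++ us))))
    f′ : ∀ {x′} → x′ ∈ xs → ∃ λ y′ → y′ ∈ us ++ vs × ρ x′ y′
    f′ x′∈ with f (there x′∈)
    ... | y′ , y′∈ , ρ′ = y′ , remove us y′∈ y′≢y , ρ′
      where
      y′≢y : y′ ≢ y
      y′≢y refl = All.lookup x∉ x′∈ (inj ρxy ρ′)

  length-bijective : ∀ {A B : Set} (ρ : A → B → Set) →
    (∀ {x x′ y} → ρ x y → ρ x′ y → x ≡ x′) →
    (∀ {x y y′} → ρ x y → ρ x y′ → y ≡ y′) →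
    ∀ {xs ys} → Unique xs → Unique ys →
    (∀ {x} → x ∈ xs → ∃ λ y → y ∈ ys × ρ x y) →
    (∀ {y} → y ∈ ys → ∃ λ x → x ∈ xs × ρ x y) →
    length xs ≡ length ys
  length-bijective ρ injˡ injʳ uxs uys f g = ℕₚ.≤-antisym
    (length-injective ρ injˡ uxs f)
    (length-injective (λ y x → ρ x y) injʳ uys g)

  -- The equivalence is asked for only on members of `xs`, since `count-after-suc` derives it from
  -- the lists being overpartitions.
  length-filter-⊎ : ∀ {A : Set} {P Q R : Pred A 0ℓ}
    (P? : Decidable P) (Q? : Decidable Q) (R? : Decidable R) xs →
    (∀ {x} → x ∈ xs → P x ⇔ (Q x ⊎ R x)) →
    (∀ {x} → Q x → R x → ⊥) →
    length (filter P? xs) ≡ length (filter Q? xs) + length (filter R? xs)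
  length-filter-⊎ P? Q? R? []       _ _  = refl
  length-filter-⊎ P? Q? R? (x ∷ xs) e d
    with P? x | Q? x | R? x | e (here refl) | length-filter-⊎ P? Q? R? xs (e ∘ there) d
  ... | _     | yes q | yes r | _  | _  = contradiction r (d q)
  ... | yes _ | yes _ | no _  | _  | ih = cong suc ih
  ... | yes _ | no _  | yes _ | _  | ih = trans (cong suc ih) (sym (ℕₚ.+-suc _ _))
  ... | no _  | no _  | no _  | _  | ih = ih
  ... | yes p | no ¬q | no ¬r | eq | _  = contradiction (Equivalence.to eq p) [ ¬q , ¬r ]
  ... | no ¬p | yes q | no _  | eq | _  = contradiction (Equivalence.from eq (inj₁ q)) ¬p
  ... | no ¬p | no _  | yes r | eq | _  = contradiction (Equivalence.from eq (inj₂ r)) ¬p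

  -- A fictitious unmarked part m in front bounds the first part: at most m if unmarked, below m if
  -- overlined. So no part exceeds m, and no part m is overlined.
  After : ℕ → List Part → Set
  After m ps = Linked _⊵_ ((m , false) ∷ ps)

  after? : ∀ m → Decidable (After m)
  after? m ps = linked? _⊵?_ ((m , false) ∷ ps)

  StartsWith : Part → List Part → Set
  StartsWith p ps = ∃ λ qs → ps ≡ p ∷ qs

  startsWith? : ∀ p → Decidable (StartsWith p)
  startsWith? p []       = no λ ()
  startsWith? p (q ∷ qs) = map′ (λ { refl → qs , refl }) (λ { (_ , refl) → refl })
    (Product.≡-dec Nat._≟_ Bool._≟_ q p)

  count : ∀ {P : Pred (List Part) 0ℓ} → Decidable P → ℕ → ℕ
  count P? n = length (filter P? (overpartitions n))

  unfold : ∀ {n ps} → ps ∈ overpartitions n → IsOverpartition n ps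
  unfold = Equivalence.to (∈-overpartitions _ _)

  fold : ∀ {n ps} → IsOverpartition n ps → ps ∈ overpartitions n
  fold = Equivalence.from (∈-overpartitions _ _)

  -- `_⊵_` ignores the mark on its left; splitting on the mark on its right only lets it compute.
  relink : ∀ {a b ps} c → Linked _⊵_ ((a , b) ∷ ps) → Linked _⊵_ ((a , c) ∷ ps)
  relink _ [-] = [-]
  relink {ps = (_ , false) ∷ _} _ (x ∷ˡ l) = x ∷ˡ l
  relink {ps = (_ , true)  ∷ _} _ (x ∷ˡ l) = x ∷ˡ l

  -- Delete the first part. The remainder sees only its size, so the condition left over is
  -- `After a` for either mark `b`.
  count-startsWith : ∀ {a b n} → 0 < a → a ≤ n →
    count (startsWith? (a , b)) n ≡ count (after? a) (n ∸ a)
  count-startsWith {a} {b} {n} 0<a a≤n =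
    length-bijective (λ ps qs → ps ≡ (a , b) ∷ qs)
      (λ p q → trans p (sym q)) (λ p q → ∷-injectiveʳ (trans (sym p) q))
      (Unique.filter⁺ _ (overpartitions-unique n))
      (Unique.filter⁺ _ (overpartitions-unique (n ∸ a)))
      tail cons
    where
    tail : ∀ {ps} → ps ∈ filter (startsWith? (a , b)) (overpartitions n) →
      ∃ λ qs → qs ∈ filter (after? a) (overpartitions (n ∸ a)) × ps ≡ (a , b) ∷ qs
    tail ps∈ with ∈-filter⁻ (startsWith? (a , b)) {xs = overpartitions n} ps∈
    ... | ps∈′ , qs , refl with unfold ps∈′
    ... | isOverpartition (_ ∷ pos) l tot =
      qs , ∈-filter⁺ (after? a) (fold (isOverpartition pos (Linked.tail l) total)) (relink false l) , refl
      where
      total = trans (sym (ℕₚ.m+n∸m≡n a _)) (cong (_∸ a) tot)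
    cons : ∀ {qs} → qs ∈ filter (after? a) (overpartitions (n ∸ a)) →
      ∃ λ ps → ps ∈ filter (startsWith? (a , b)) (overpartitions n) × ps ≡ (a , b) ∷ qs
    cons {qs} qs∈ with ∈-filter⁻ (after? a) {xs = overpartitions (n ∸ a)} qs∈
    ... | qs∈′ , l with unfold qs∈′
    ... | isOverpartition pos _ tot =
      (a , b) ∷ qs ,
      ∈-filter⁺ (startsWith? (a , b)) (fold (isOverpartition (0<a ∷ pos) (relink b l) total)) (qs , refl) ,
      refl
      where
      total = trans (cong (λ x → a + x) tot) (ℕₚ.m+[n∸m]≡n a≤n)

  count-none : ∀ {P : Pred (List Part) 0ℓ} (P? : Decidable P) n →
    (∀ {ps} → IsOverpartition n ps → ¬ P ps) → count P? n ≡ 0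
  count-none P? n ¬P = cong length
    (filter-none P? {xs = overpartitions n} (All.tabulate (λ ps∈ → ¬P (unfold ps∈))))

  count-startsWith-large : ∀ {a b n} → n < a → count (startsWith? (a , b)) n ≡ 0
  count-startsWith-large {a} {b} {n} n<a = count-none (startsWith? (a , b)) n
    λ { o (_ , refl) → ℕₚ.<⇒≱ n<a
        (ℕₚ.≤-trans (ℕₚ.m≤m+n a _) (ℕₚ.≤-reflexive (IsOverpartition.total o))) }

  count-startsWith-zero : ∀ {b} n → count (startsWith? (0 , b)) n ≡ 0
  count-startsWith-zero {b} n = count-none (startsWith? (0 , b)) n
    λ { o (_ , refl) → case-pos (IsOverpartition.positive o) }
    where
    case-pos : ∀ {ps} → ¬ All (λ p → 0 < size p) ((0 , b) ∷ ps)
    case-pos (() ∷ _)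

  AfterOrOverlined : ℕ → List Part → Set
  AfterOrOverlined m ps = After m ps ⊎ StartsWith (m , true) ps

  afterOrOverlined? : ∀ m → Decidable (AfterOrOverlined m)
  afterOrOverlined? m ps with after? m ps | startsWith? (m , true) ps
  ... | yes a | _     = yes (inj₁ a)
  ... | no _  | yes s = yes (inj₂ s)
  ... | no ¬a | no ¬s = no [ ¬a , ¬s ]

  -- Raising the bound from m to m + 1 admits exactly two new first parts, the overlined m and the
  -- unmarked m + 1; the overlined m + 1 has to wait for the next step.
  count-after-suc : ∀ m n → count (after? (suc m)) n ≡
    count (after? m) n + count (startsWith? (m , true)) n + count (startsWith? (suc m , false)) n
  count-after-suc m n = trans
    (length-filter-⊎ (after? (suc m)) (afterOrOverlined? m) (startsWith? (suc m , false))
      (overpartitions n) (λ ps∈ → mk⇔ (to (unfold ps∈)) (from (unfold ps∈))) disjoint)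
    (cong (_+ count (startsWith? (suc m , false)) n)
      (length-filter-⊎ (afterOrOverlined? m) (after? m) (startsWith? (m , true))
        (overpartitions n) (λ _ → mk⇔ (λ x → x) (λ x → x))
        λ { (m<m ∷ˡ _) (_ , refl) → ℕₚ.<-irrefl refl m<m }))
    where
    to : ∀ {ps} → IsOverpartition n ps → After (suc m) ps →
      AfterOrOverlined m ps ⊎ StartsWith (suc m , false) ps
    to {[]} _ _ = inj₁ (inj₁ [-])
    to {(c , false) ∷ _} _ (c≤ ∷ˡ l) with c Nat.≟ suc m
    ... | yes refl = inj₂ (_ , refl)
    ... | no  c≢   = inj₁ (inj₁ (ℕₚ.≤-pred (ℕₚ.≤∧≢⇒< c≤ c≢) ∷ˡ l))
    to {(c , true) ∷ _} _ (c< ∷ˡ l) with c Nat.≟ m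
    ... | yes refl = inj₁ (inj₂ (_ , refl))
    ... | no  c≢   = inj₁ (inj₁ (ℕₚ.≤∧≢⇒< (ℕₚ.≤-pred c<) c≢ ∷ˡ l))
    from : ∀ {ps} → IsOverpartition n ps →
      AfterOrOverlined m ps ⊎ StartsWith (suc m , false) ps → After (suc m) ps
    from {[]} _ _ = [-]
    from {(c , false) ∷ _} _ (inj₁ (inj₁ (c≤ ∷ˡ l))) = ℕₚ.m≤n⇒m≤1+n c≤ ∷ˡ l
    from {(c , true)  ∷ _} _ (inj₁ (inj₁ (c< ∷ˡ l))) = ℕₚ.m≤n⇒m≤1+n c< ∷ˡ l
    from o (inj₁ (inj₂ (_ , refl))) = ℕₚ.≤-refl ∷ˡ IsOverpartition.linked o
    from o (inj₂ (_ , refl))        = ℕₚ.≤-refl ∷ˡ IsOverpartition.linked o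
    disjoint : ∀ {ps} → AfterOrOverlined m ps → StartsWith (suc m , false) ps → ⊥
    disjoint (inj₁ (m<m ∷ˡ _)) (_ , refl) = ℕₚ.<-irrefl refl m<m
    disjoint (inj₂ (_ , ()))  (_ , refl)

  count-after-zero : ∀ n → count (after? 0) (suc n) ≡ 0
  count-after-zero n = count-none (after? 0) (suc n) none
    where
    none : ∀ {ps} → IsOverpartition (suc n) ps → ¬ After 0 ps
    none {[]}              (isOverpartition _ _ ())         _
    none {(_ , false) ∷ _} (isOverpartition (0<c ∷ _) _ _) (c≤0 ∷ˡ _) = ℕₚ.<⇒≱ 0<c c≤0

  -- The first part is at most n, hence below m, so even an overlined one may follow the unmarked m.
  count-after-large : ∀ {m n} → n < m → count (after? m) n ≡ p̄ n
  count-after-large {m} {n} n<m = cong length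
    (filter-all (after? m) {xs = overpartitions n} (All.tabulate (λ ps∈ → all (unfold ps∈))))
    where
    all : ∀ {ps} → IsOverpartition n ps → After m ps
    all {[]}            _                         = [-]
    all {(c , b) ∷ ps} (isOverpartition _ l tot) = relate b c<m l
      where
      c<m : c < m
      c<m = ℕₚ.≤-<-trans (ℕₚ.≤-trans (ℕₚ.m≤m+n c _) (ℕₚ.≤-reflexive tot)) n<m
      relate : ∀ b → c < m → Linked _⊵_ ((c , b) ∷ ps) → After m ((c , b) ∷ ps)
      relate false c<m l = ℕₚ.<⇒≤ c<m ∷ˡ l
      relate true  c<m l = c<m ∷ˡ l

-- Generating functions of the bounded counts.

-- A power series f is the function ℤ → ℤ of its coefficients, zero on negative
-- arguments; the series q^k f is z ↦ f (z - k).
module Series where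
  open Counting
  open Int using (_+_; _-_; _*_; -_)
  open ≡-Reasoning

  extend : (ℕ → ℕ) → ℤ → ℤ
  extend f (+ n)    = + f n
  extend f -[1+ _ ] = + 0

  p : ℤ → ℤ
  p = extend p̄

  -- The product of 1 + q^k over 1 ≤ k < m divided by the product of 1 - q^k over 1 ≤ k ≤ m, since a
  -- part m is never overlined.
  H : ℕ → ℤ → ℤ
  H m = extend (count (after? m))

  δ : ℤ → ℤ
  δ (+ zero)  = + 1
  δ (+ suc _) = + 0
  δ -[1+ _ ]  = + 0

  extend-negative : ∀ f {z} → z Int.< + 0 → extend f z ≡ + 0
  extend-negative f {+ _}      (Int.+<+ ())
  extend-negative f { -[1+ _ ]} _ = refl

  extend-⊖-≥ : ∀ f {m n} → n ≤ m → extend f (+ m - + n) ≡ + f (m Nat.∸ n)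
  extend-⊖-≥ f {m} {n} n≤m = cong (extend f) (trans (ℤₚ.m-n≡m⊖n m n) (ℤₚ.⊖-≥ n≤m))

  m<n⇒m-n<0 : ∀ {m n} → m < n → + m - + n Int.< + 0
  m<n⇒m-n<0 {m} {n} m<n = subst (+ m - + n Int.<_) (ℤₚ.+-inverseʳ (+ n))
    (ℤₚ.+-monoˡ-< (- + n) (Int.+<+ m<n))

  -- Vanishing at negative arguments covers the case a > n, so the shift by a needs no side
  -- condition.
  startsWith-series : ∀ {a} b n → 0 < a → + count (startsWith? (a , b)) n ≡ H a (+ n - + a)
  startsWith-series {a} b n 0<a with a Nat.≤? n
  ... | yes a≤n = trans (cong +_ (count-startsWith 0<a a≤n)) (sym (extend-⊖-≥ _ a≤n))
  ... | no  a≰n = trans (cong +_ (count-startsWith-large {b = b} (ℕₚ.≰⇒> a≰n)))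
    (sym (extend-negative _ (m<n⇒m-n<0 (ℕₚ.≰⇒> a≰n))))

  -- Overpartitions into parts of size at most m.
  Q : ℕ → ℤ → ℤ
  Q zero      z = H zero z
  Q m@(suc _) z = H m z + H m (z - + m)

  H-zero : ∀ z → H zero z ≡ δ z
  H-zero (+ zero)  = refl
  H-zero (+ suc n) = cong +_ (count-after-zero n)
  H-zero -[1+ n ]  = refl

  -- As series, (1 - q^(m+1)) H_(m+1) = Q_m: an unmarked first part m + 1 gives the shifted term,
  -- and the rest is H_m plus, for m > 0, the lists starting with an overlined m.
  H-suc : ∀ m z → H (suc m) z ≡ Q m z + H (suc m) (z - + suc m)
  H-suc zero    -[1+ n ] = refl
  H-suc (suc m) -[1+ n ] = refl
  H-suc zero    (+ n)    = trans (cong +_ (count-after-suc 0 n))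
    (cong₂ (λ x y → x + y)
      (trans (cong (λ x → h + + x) (count-startsWith-zero n)) (ℤₚ.+-identityʳ h))
      (startsWith-series false n (s≤s z≤n)))
    where
    h = + count (after? 0) n
  H-suc (suc m) (+ n)    = trans (cong +_ (count-after-suc (suc m) n))
    (cong₂ (λ x y → + (count (after? (suc m)) n) + x + y)
      (startsWith-series true n (s≤s z≤n)) (startsWith-series false n (s≤s z≤n)))

  -- At z ≤ m the shifted term of `H-suc` has a negative argument, and the bound m + 1 is no
  -- restriction.
  Q-p : ∀ m {z} → z Int.≤ + m → Q m z ≡ p z
  Q-p zero    { -[1+ _ ]} _ = refl
  Q-p (suc m) { -[1+ _ ]} _ = refl
  Q-p m {+ n} (Int.+≤+ n≤m) = begin
    Q m (+ n)                               ≡⟨ ℤₚ.+-identityʳ _ ⟨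
    Q m (+ n) + + 0                         ≡⟨ cong (λ x → Q m (+ n) + x) negative ⟨
    Q m (+ n) + H (suc m) (+ n - + suc m)   ≡⟨ H-suc m (+ n) ⟨
    H (suc m) (+ n)                         ≡⟨ cong +_ (count-after-large (s≤s n≤m)) ⟩
    p (+ n)                                 ∎
    where
    negative = extend-negative _ (m<n⇒m-n<0 (s≤s n≤m))

  VanishesBelow0 : (ℤ → ℤ) → Set
  VanishesBelow0 f = ∀ {z} → z Int.< + 0 → f z ≡ + 0

  -- 1 - q^(1+k) is not a zero divisor.
  cancel : ∀ k {f g} → VanishesBelow0 f → VanishesBelow0 g →
    (∀ z → f z - f (z - + suc k) ≡ g z - g (z - + suc k)) → ∀ z → f z ≡ g z
  cancel k {f} {g} f0 g0 eq -[1+ n ] = trans (f0 Int.-<+) (sym (g0 Int.-<+))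
  cancel k {f} {g} f0 g0 eq (+ n)    = go n (<-wellFounded n)
    where
    step : ∀ z → f (z - + suc k) ≡ g (z - + suc k) → f z ≡ g z
    step z e = begin
      f z                                          ≡⟨ a-b+b (f z) (f (z - + suc k)) ⟨
      f z - f (z - + suc k) + f (z - + suc k)      ≡⟨ cong₂ _+_ (eq z) e ⟩
      g z - g (z - + suc k) + g (z - + suc k)      ≡⟨ a-b+b (g z) (g (z - + suc k)) ⟩
      g z                                          ∎
      where
      a-b+b : ∀ a b → a - b + b ≡ a
      a-b+b = ℤ-Solver.solve-∀
    go : ∀ n → Acc Nat._<_ n → f (+ n) ≡ g (+ n)
    go n (acc rs) with suc k Nat.≤? n
    ... | no  k≮n = step (+ n) (trans (f0 neg) (sym (g0 neg)))
      where neg = m<n⇒m-n<0 (ℕₚ.≰⇒> k≮n)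
    ... | yes k<n = step (+ n) (subst (λ z → f z ≡ g z) (sym (trans (ℤₚ.m-n≡m⊖n n (suc k)) (ℤₚ.⊖-≥ k<n)))
      (go (n Nat.∸ suc k) (rs (ℕₚ.∸-monoʳ-< {n} (s≤s z≤n) k<n))))

  -- Shanks' partial sums and Gauss's identity.

  ε : ℕ → ℤ
  ε zero    = + 1
  ε (suc k) = - ε k

  -- f · (1 + 2 ∑_{k=1}^{n} (-1)^k q^(k²))
  theta : ℕ → (ℤ → ℤ) → ℤ → ℤ
  theta zero    f z = f z
  theta (suc k) f z = theta k f z + + 2 * (ε (suc k) * f (z - + (suc k Nat.* suc k)))

  -- 1 + 2 ∑_{s=1}^{j} (-1)^s q^(t s) H_s
  partial : ℕ → ℕ → ℤ → ℤ
  partial t zero    z = δ z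
  partial t (suc j) z = partial t j z + + 2 * (ε (suc j) * H (suc j) (z - + (suc j Nat.* t)))

  shift₂ : ∀ z a b → z - + a - + b ≡ z - + (a Nat.+ b)
  shift₂ z a b = trans (lemma z (+ a) (+ b)) (cong (λ x → z - x) (sym (ℤₚ.pos-+ a b)))
    where
    lemma : ∀ z a b → z - a - b ≡ z - (a + b)
    lemma = ℤ-Solver.solve-∀

  shift-comm : ∀ (f : ℤ → ℤ) z a b → f (z - + a - + b) ≡ f (z - + b - + a)
  shift-comm f z a b = cong f (lemma z (+ a) (+ b))
    where
    lemma : ∀ z a b → z - a - b ≡ z - b - a
    lemma = ℤ-Solver.solve-∀

  shift-cong : ∀ (f : ℤ → ℤ) z a b {c} → a Nat.+ b ≡ c → f (z - + a - + b) ≡ f (z - + c)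
  shift-cong f z a b refl = cong f (shift₂ z a b)

  -- By `H-suc` both sides are (1 - q^(2m+2)) H_(m+1). This is the product recursion Q_(m+1) = Q_m
  -- (1 + q^(m+1)) / (1 - q^(m+1)) with the denominator cleared.
  Q-step : ∀ m z → Q (suc m) z - Q (suc m) (z - + suc m) ≡ Q m z + Q m (z - + suc m)
  Q-step m z = begin
    (h₀ + h₁) - (h₁ + h₂)           ≡⟨ lemma₁ h₀ h₁ h₂ ⟩
    (h₀ - h₁) + (h₁ - h₂)           ≡⟨ cong₂ (λ x y → (x - h₁) + (y - h₂)) (H-suc m z) (H-suc m _) ⟩
    (Q m z + h₁ - h₁) + (Q m (z - + suc m) + h₂ - h₂) ≡⟨ lemma₂ (Q m z) (Q m (z - + suc m)) h₁ h₂ ⟩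
    Q m z + Q m (z - + suc m)       ∎
    where
    h₀ = H (suc m) z
    h₁ = H (suc m) (z - + suc m)
    h₂ = H (suc m) (z - + suc m - + suc m)
    lemma₁ : ∀ a b c → (a + b) - (b + c) ≡ (a - b) + (b - c)
    lemma₁ = ℤ-Solver.solve-∀
    lemma₂ : ∀ a b c d → (a + c - c) + (b + d - d) ≡ a + b
    lemma₂ = ℤ-Solver.solve-∀

  -- Induction on j. With s = j + 1, Q_j = (1 - q^s) H_s and Q_s = (1 + q^s) H_s, so the terms added
  -- on the two sides agree by (1 + q^t) - q^t (1 + q^s) - (1 - q^s) = q^s (1 - q^t).
  partial-step : ∀ t j z →
    partial (suc t) j z - partial (suc t) j (z - + t) ≡
    partial t j z + partial t j (z - + t) - + 2 * (ε j * Q j (z - + (suc j Nat.* t)))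
  partial-step t zero z = begin
    δ z - δ (z - + t)
      ≡⟨ lemma (δ z) _ ⟩
    δ z + δ (z - + t) - + 2 * (+ 1 * δ (z - + t))
      ≡⟨ cong (λ x → δ z + δ (z - + t) - + 2 * (+ 1 * x)) eq ⟨
    δ z + δ (z - + t) - + 2 * (+ 1 * H zero (z - + (1 Nat.* t))) ∎
    where
    lemma : ∀ a b → a - b ≡ a + b - + 2 * (+ 1 * b)
    lemma = ℤ-Solver.solve-∀
    eq : H zero (z - + (1 Nat.* t)) ≡ δ (z - + t)
    eq = trans (H-zero _) (cong (λ k → δ (z - + k)) (ℕₚ.*-identityˡ t))
  partial-step t (suc j) z = begin
    (B + + 2 * (- e * H s (z - + (s Nat.* suc t)))) -
      (B′ + + 2 * (- e * H s (z - + t - + (s Nat.* suc t))))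
      ≡⟨ cong₂ (λ x y → (B + + 2 * (- e * x)) - (B′ + + 2 * (- e * y))) eq₁ eq₂ ⟩
    (B + + 2 * (- e * h₁)) - (B′ + + 2 * (- e * h₁′))
      ≡⟨ lemma₁ B B′ e h₁ h₁′ ⟩
    (B - B′) + + 2 * (e * (h₁′ - h₁))
      ≡⟨ cong (_+ + 2 * (e * (h₁′ - h₁))) (partial-step t j z) ⟩
    (A + A′ - + 2 * (e * Q j y)) + + 2 * (e * (h₁′ - h₁))
      ≡⟨ cong (λ x → (A + A′ - + 2 * (e * x)) + + 2 * (e * (h₁′ - h₁))) eqQ ⟩
    (A + A′ - + 2 * (e * (h₀ - h₁))) + + 2 * (e * (h₁′ - h₁))
      ≡⟨ lemma₂ A A′ e h₀ h₁ h₀′ h₁′ ⟩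
    ((A + + 2 * (- e * h₀)) + (A′ + + 2 * (- e * h₀′))) - + 2 * (- e * (h₀′ + h₁′))
      ≡⟨ cong₂ (λ x y → ((A + + 2 * (- e * h₀)) + (A′ + + 2 * (- e * x))) - + 2 * (- e * y)) eq₃ eq₄ ⟩
    partial t s z + partial t s (z - + t) - + 2 * (- e * Q s (z - + (suc s Nat.* t))) ∎
    where
    s = suc j
    e = ε j
    A = partial t j z
    A′ = partial t j (z - + t)
    B = partial (suc t) j z
    B′ = partial (suc t) j (z - + t)
    y = z - + (s Nat.* t)
    -- On top of the shift by s t in `y`, the index 1 marks a further shift by s and the prime a
    -- further shift by t.
    h₀ = H s y
    h₁ = H s (y - + s)
    h₀′ = H s (y - + t)
    h₁′ = H s (y - + t - + s)
    st+s : s Nat.* t Nat.+ s ≡ s Nat.* suc t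
    st+s = trans (ℕₚ.+-comm (s Nat.* t) s) (sym (ℕₚ.*-suc s t))
    eq₁ : H s (z - + (s Nat.* suc t)) ≡ h₁
    eq₁ = sym (shift-cong (H s) z (s Nat.* t) s st+s)
    eq₂ : H s (z - + t - + (s Nat.* suc t)) ≡ h₁′
    eq₂ = sym (trans (cong (λ x → H s (x - + s)) (lemma z (+ t) (+ (s Nat.* t))))
      (shift-cong (H s) (z - + t) (s Nat.* t) s st+s))
      where
      lemma : ∀ z a b → z - b - a ≡ z - a - b
      lemma = ℤ-Solver.solve-∀
    eqQ : Q j y ≡ h₀ - h₁
    eqQ = trans (sym (lemma (Q j y) h₁)) (cong (_- h₁) (sym (H-suc j y)))
      where
      lemma : ∀ a b → a + b - b ≡ a
      lemma = ℤ-Solver.solve-∀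
    eq₃ : h₀′ ≡ H s (z - + t - + (s Nat.* t))
    eq₃ = shift-comm (H s) z (s Nat.* t) t
    eq₄ : h₀′ + h₁′ ≡ Q s (z - + (suc s Nat.* t))
    eq₄ = trans (shift-comm (Q s) z (s Nat.* t) t) (cong (Q s) (shift₂ z t (s Nat.* t)))
    lemma₁ : ∀ B B′ e x y → (B + + 2 * (- e * x)) - (B′ + + 2 * (- e * y)) ≡
      (B - B′) + + 2 * (e * (y - x))
    lemma₁ = ℤ-Solver.solve-∀
    lemma₂ : ∀ A A′ e h₀ h₁ h₀′ h₁′ →
      (A + A′ - + 2 * (e * (h₀ - h₁))) + + 2 * (e * (h₁′ - h₁)) ≡
      ((A + + 2 * (- e * h₀)) + (A′ + + 2 * (- e * h₀′))) - + 2 * (- e * (h₀′ + h₁′))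
    lemma₂ = ℤ-Solver.solve-∀

  -- `theta k` is linear and commutes with shifts, so `Q-step` passes through it.
  theta-step : ∀ m k z → theta k (Q (suc m)) z - theta k (Q (suc m)) (z - + suc m) ≡
    theta k (Q m) z + theta k (Q m) (z - + suc m)
  theta-step m zero    z = Q-step m z
  theta-step m (suc k) z = begin
    (a + + 2 * (e * b)) - (a′ + + 2 * (e * b′)) ≡⟨ lemma₁ a a′ b b′ e ⟩
    (a - a′) + + 2 * (e * (b - b′)) ≡⟨ cong₂ (λ x y → x + + 2 * (e * y)) (theta-step m k z) eq ⟩
    (c + c′) + + 2 * (e * (d + d′)) ≡⟨ lemma₂ c c′ d d′ e ⟩
    (c + + 2 * (e * d)) + (c′ + + 2 * (e * d′)) ∎
    where
    sq = suc k Nat.* suc k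
    e = ε (suc k)
    a = theta k (Q (suc m)) z
    a′ = theta k (Q (suc m)) (z - + suc m)
    c = theta k (Q m) z
    c′ = theta k (Q m) (z - + suc m)
    b = Q (suc m) (z - + sq)
    b′ = Q (suc m) (z - + suc m - + sq)
    d = Q m (z - + sq)
    d′ = Q m (z - + suc m - + sq)
    eq : b - b′ ≡ d + d′
    eq = begin
      b - b′ ≡⟨ cong (λ x → b - x) (shift-comm (Q (suc m)) z (suc m) sq) ⟩
      b - Q (suc m) (z - + sq - + suc m) ≡⟨ Q-step m (z - + sq) ⟩
      d + Q m (z - + sq - + suc m) ≡⟨ cong (λ x → d + x) (shift-comm (Q m) z sq (suc m)) ⟩
      d + d′ ∎
    lemma₁ : ∀ a a′ b b′ e → (a + + 2 * (e * b)) - (a′ + + 2 * (e * b′)) ≡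
      (a - a′) + + 2 * (e * (b - b′))
    lemma₁ = ℤ-Solver.solve-∀
    lemma₂ : ∀ c c′ d d′ e → (c + c′) + + 2 * (e * (d + d′)) ≡
      (c + + 2 * (e * d)) + (c′ + + 2 * (e * d′))
    lemma₂ = ℤ-Solver.solve-∀

  z-n<0 : ∀ {z} n → z Int.< + 0 → z - + n Int.< + 0
  z-n<0 {z} n z<0 = ℤₚ.≤-<-trans (ℤₚ.i-j≤i z (+ n)) z<0

  H-negative : ∀ m → VanishesBelow0 (H m)
  H-negative m = extend-negative _

  Q-negative : ∀ m → VanishesBelow0 (Q m)
  Q-negative zero    z<0 = H-negative zero z<0
  Q-negative (suc m) z<0 = cong₂ _+_ (H-negative (suc m) z<0) (H-negative (suc m) (z-n<0 (suc m) z<0))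

  add-zero : ∀ e {x y} → x ≡ + 0 → y ≡ + 0 → x + + 2 * (e * y) ≡ + 0
  add-zero e refl refl = lemma e
    where
    lemma : ∀ e → + 0 + + 2 * (e * + 0) ≡ + 0
    lemma = ℤ-Solver.solve-∀

  theta-negative : ∀ k {f} → VanishesBelow0 f → VanishesBelow0 (theta k f)
  theta-negative zero    f0 z<0 = f0 z<0
  theta-negative (suc k) f0 z<0 = add-zero (ε (suc k)) (theta-negative k f0 z<0) (f0 (z-n<0 _ z<0))

  partial-negative : ∀ t j → VanishesBelow0 (partial t j)
  partial-negative t zero    {+ _} (Int.+<+ ())
  partial-negative t zero    { -[1+ _ ]} _ = refl
  partial-negative t (suc j) z<0 =
    add-zero (ε (suc j)) (partial-negative t j z<0) (H-negative (suc j) (z-n<0 _ z<0))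

  -- Shanks' finite form of Gauss's identity ∑ (-1)^k q^(k²) = ∏ (1 - q^k)/(1 + q^k).
  shanks : ∀ n z → theta n (Q n) z ≡ partial (suc n) n z
  shanks zero    z = H-zero z
  shanks (suc n) = cancel n
    (theta-negative (suc n) (Q-negative (suc n))) (partial-negative (suc (suc n)) (suc n)) eq
    where
    t = suc n
    e = ε (suc n)
    s = suc n Nat.* suc n
    eq : ∀ z → theta t (Q t) z - theta t (Q t) (z - + t) ≡
      partial (suc t) t z - partial (suc t) t (z - + t)
    eq z = begin
      theta t (Q t) z - theta t (Q t) (z - + t)
        ≡⟨ theta-step n t z ⟩
      theta t (Q n) z + theta t (Q n) (z - + t)
        ≡⟨ cong₂ (λ x y → (x + + 2 * (e * Q n (z - + s))) + (y + + 2 * (e * Q n (z - + t - + s))))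
             (shanks n z) (shanks n (z - + t)) ⟩
      (a + + 2 * (e * Q n (z - + s))) + (a′ + + 2 * (e * Q n (z - + t - + s)))
        ≡⟨ cong₂ (λ x y → (a + + 2 * (e * x)) + (a′ + + 2 * (e * y)))
             (eqQ (z - + s)) (trans (shift-comm (Q n) z t s) (eqQ (z - + s - + t))) ⟩
      -- The theta term of index t and the last term of `partial t t` carry the same power q^(t t).
      -- With Q_n = (1 - q^t) H_t, what is left over is exactly the correction term of
      -- `partial-step t t`.
      (a + + 2 * (e * (h₀ - h₁))) + (a′ + + 2 * (e * (h₁ - h₂)))
        ≡⟨ lemma a a′ e h₀ h₁ h₂ ⟩
      ((a + + 2 * (e * h₀)) + (a′ + + 2 * (e * h₁))) - + 2 * (e * (h₁ + h₂))
        ≡⟨ cong₂ (λ x y → ((a + + 2 * (e * h₀)) + (a′ + + 2 * (e * x))) - + 2 * (e * y))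
             (shift-comm (H t) z s t) (cong (Q t) lemma′) ⟩
      partial t t z + partial t t (z - + t) - + 2 * (e * Q t (z - + (suc t Nat.* t)))
        ≡⟨ partial-step t t z ⟨
      partial (suc t) t z - partial (suc t) t (z - + t) ∎
      where
      a = partial t n z
      a′ = partial t n (z - + t)
      h₀ = H t (z - + s)
      h₁ = H t (z - + s - + t)
      h₂ = H t (z - + s - + t - + t)
      eqQ : ∀ y → Q n y ≡ H t y - H t (y - + t)
      eqQ y = trans (sym (lemma″ (Q n y) (H t (y - + t)))) (cong (_- H t (y - + t)) (sym (H-suc n y)))
        where
        lemma″ : ∀ a b → a + b - b ≡ a
        lemma″ = ℤ-Solver.solve-∀
      lemma′ : z - + s - + t ≡ z - + (t Nat.+ s)
      lemma′ = trans (shift₂ z s t) (cong (λ k → z - + k) (ℕₚ.+-comm s t))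
      lemma : ∀ a a′ e h₀ h₁ h₂ → (a + + 2 * (e * (h₀ - h₁))) + (a′ + + 2 * (e * (h₁ - h₂))) ≡
        ((a + + 2 * (e * h₀)) + (a′ + + 2 * (e * h₁))) - + 2 * (e * (h₁ + h₂))
      lemma = ℤ-Solver.solve-∀

  shift-≤ : ∀ {z m} n → z Int.≤ + m → z - + n Int.≤ + m
  shift-≤ {z} n z≤m = ℤₚ.≤-trans (ℤₚ.i-j≤i z (+ n)) z≤m

  theta-cong : ∀ {f g m} → (∀ {z} → z Int.≤ + m → f z ≡ g z) →
    ∀ k {z} → z Int.≤ + m → theta k f z ≡ theta k g z
  theta-cong f≗g zero    z≤m = f≗g z≤m
  theta-cong f≗g (suc k) z≤m =
    cong₂ (λ x y → x + + 2 * (ε (suc k) * y)) (theta-cong f≗g k z≤m) (f≗g (shift-≤ _ z≤m))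

  -- The terms beyond δ carry powers q^(s t) with s ≥ 1, which do not reach degrees below t.
  partial-low : ∀ t j {z} → z Int.< + t → partial t j z ≡ δ z
  partial-low t zero    _   = refl
  partial-low t (suc j) {z} z<t = begin
    partial t j z + + 2 * (ε (suc j) * H (suc j) (z - + (suc j Nat.* t)))
      ≡⟨ cong₂ (λ x y → x + + 2 * (ε (suc j) * y)) (partial-low t j z<t) (H-negative (suc j) negative) ⟩
    δ z + + 2 * (ε (suc j) * + 0) ≡⟨ lemma (δ z) (ε (suc j)) ⟩
    δ z ∎
    where
    lemma : ∀ a e → a + + 2 * (e * + 0) ≡ a
    lemma = ℤ-Solver.solve-∀
    negative : z - + (suc j Nat.* t) Int.< + 0
    negative = subst (z - + (suc j Nat.* t) Int.<_) (ℤₚ.+-inverseʳ (+ (suc j Nat.* t)))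
      (ℤₚ.+-monoˡ-< (- + (suc j Nat.* t)) (ℤₚ.<-≤-trans z<t (Int.+≤+ (ℕₚ.m≤m+n t (j Nat.* t)))))

  -- Up to degree m, Q_m has the coefficients of p, and the corrections in `partial (suc m) m` start
  -- only at degree m + 1.
  gauss : ∀ m {z} → z Int.≤ + m → theta m p z ≡ δ z
  gauss m {z} z≤m = begin
    theta m p z         ≡⟨ theta-cong (Q-p m) m z≤m ⟨
    theta m (Q m) z     ≡⟨ shanks m z ⟩
    partial (suc m) m z ≡⟨ partial-low (suc m) m (ℤₚ.≤-<-trans z≤m (Int.+<+ ℕₚ.≤-refl)) ⟩
    δ z                 ∎

-- The binary form 2x² + z².

module Forms where
  open Nat using (_+_; _*_)

  -- x² is written twice to match n - k² - l² - m² at k = l.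
  Solves : ℕ → ℕ × ℕ → Set
  Solves n (x , z) = x * x + x * x + z * z ≡ n

  solves? : ∀ n → Decidable (Solves n)
  solves? n (x , z) = x * x + x * x + z * z Nat.≟ n

  -- Zero is left out, and the descending order follows the recursion of `∑`, so that `∑-δ` goes by
  -- induction.
  range : ℕ → List ℕ
  range = applyDownFrom suc

  solutions : ℕ → List (ℕ × ℕ)
  solutions n = filter (solves? n) (cartesianProduct (range n) (range n))

  SumOfTwoSquares : ℕ → Set
  SumOfTwoSquares n = ∃ λ x → ∃ λ y → n ≡ x * x + y * y

-- Divisibility of overpartition numbers by 8 and 16.

module Congruences where
  open Series
  open Forms
  open Int using (_+_; _-_; _*_; -_)
  open ≡-Reasoning

  ∑ : ℕ → (ℕ → ℤ) → ℤ
  ∑ zero    f = + 0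
  ∑ (suc n) f = f (suc n) + ∑ n f

  ∑-cong : ∀ {f g} n → (∀ k → f (suc k) ≡ g (suc k)) → ∑ n f ≡ ∑ n g
  ∑-cong zero    _  = refl
  ∑-cong (suc n) eq = cong₂ _+_ (eq n) (∑-cong n eq)

  *-distribˡ-∑ : ∀ n a f → a * ∑ n f ≡ ∑ n (λ k → a * f k)
  *-distribˡ-∑ zero    a f = ℤₚ.*-zeroʳ a
  *-distribˡ-∑ (suc n) a f = trans (ℤₚ.*-distribˡ-+ a (f (suc n)) (∑ n f))
    (cong (λ x → a * f (suc n) + x) (*-distribˡ-∑ n a f))

  ∑-distrib-+ : ∀ n f g → ∑ n (λ k → f k + g k) ≡ ∑ n f + ∑ n g
  ∑-distrib-+ zero    f g = refl
  ∑-distrib-+ (suc n) f g = trans (cong (λ x → f (suc n) + g (suc n) + x) (∑-distrib-+ n f g))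
    (lemma (f (suc n)) (g (suc n)) (∑ n f) (∑ n g))
    where
    lemma : ∀ a b c d → a + b + (c + d) ≡ a + c + (b + d)
    lemma = ℤ-Solver.solve-∀

  infix 4 _≈_

  -- A record, so that both sides can be inferred from a proof; the difference `a - b` alone does
  -- not determine them.
  record _≈_ (a b : ℤ) : Set where
    constructor ∣⇒≈
    field ≈⇒∣ : + 2 ∣ℤ a - b

  open _≈_

  ≈-refl : ∀ {a} → a ≈ a
  ≈-refl {a} = ∣⇒≈ (∣ℤ.divides (+ 0) (ℤₚ.+-inverseʳ a))

  ≈-trans : ∀ {a b c} → a ≈ b → b ≈ c → a ≈ c
  ≈-trans {a} {b} {c} (∣⇒≈ p) (∣⇒≈ q) = ∣⇒≈ (subst (+ 2 ∣ℤ_) (lemma a b c) (∣ℤ.∣m∣n⇒∣m+n p q))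
    where
    lemma : ∀ a b c → (a - b) + (b - c) ≡ a - c
    lemma = ℤ-Solver.solve-∀

  +-cong-≈ : ∀ {a b c d} → a ≈ b → c ≈ d → a + c ≈ b + d
  +-cong-≈ {a} {b} {c} {d} (∣⇒≈ p) (∣⇒≈ q) =
    ∣⇒≈ (subst (+ 2 ∣ℤ_) (lemma a b c d) (∣ℤ.∣m∣n⇒∣m+n p q))
    where
    lemma : ∀ a b c d → (a - b) + (c - d) ≡ (a + c) - (b + d)
    lemma = ℤ-Solver.solve-∀

  +2*-≈ : ∀ a b → a + + 2 * b ≈ a
  +2*-≈ a b = ∣⇒≈ (∣ℤ.divides b (lemma a b))
    where
    lemma : ∀ a b → (a + + 2 * b) - a ≡ b * + 2
    lemma = ℤ-Solver.solve-∀

  ε*-≈ : ∀ k {a b} → a ≈ b → ε k * a ≈ b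
  ε*-≈ zero    {a} {b} p = subst (_≈ b) (sym (ℤₚ.*-identityˡ a)) p
  ε*-≈ (suc k) {a} {b} p = ≈-trans (∣⇒≈ (∣ℤ.divides (- (ε k * a)) (lemma (ε k) a))) (ε*-≈ k p)
    where
    lemma : ∀ e a → - e * a - e * a ≡ - (e * a) * + 2
    lemma = ℤ-Solver.solve-∀

  ∑-cong-≈ : ∀ {f g} n → (∀ k → f (suc k) ≈ g (suc k)) → ∑ n f ≈ ∑ n g
  ∑-cong-≈ zero    _  = ≈-refl
  ∑-cong-≈ (suc n) eq = +-cong-≈ (eq n) (∑-cong-≈ n eq)

  -- Off the diagonal, the equal terms at (k , l) and (l , k) cancel modulo 2.
  ∑-symmetric : ∀ (f : ℕ → ℕ → ℤ) → (∀ k l → f k l ≡ f l k) →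
    ∀ n → ∑ n (λ k → ∑ n (f k)) ≈ ∑ n (λ k → f k k)
  ∑-symmetric f f-sym zero    = ≈-refl
  ∑-symmetric f f-sym (suc n) = subst (_≈ f s s + ∑ n (λ k → f k k)) (sym split)
    (+-cong-≈ (+2*-≈ (f s s) (∑ n (f s))) (∑-symmetric f f-sym n))
    where
    s = suc n
    split : (f s s + ∑ n (f s)) + ∑ n (λ k → f k s + ∑ n (f k)) ≡
      (f s s + + 2 * ∑ n (f s)) + ∑ n (λ k → ∑ n (f k))
    split = begin
      (f s s + ∑ n (f s)) + ∑ n (λ k → f k s + ∑ n (f k))
        ≡⟨ cong (λ x → (f s s + ∑ n (f s)) + x) (∑-distrib-+ n (λ k → f k s) (λ k → ∑ n (f k))) ⟩
      (f s s + ∑ n (f s)) + (∑ n (λ k → f k s) + ∑ n (λ k → ∑ n (f k)))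
        ≡⟨ cong (λ x → (f s s + ∑ n (f s)) + (x + ∑ n (λ k → ∑ n (f k))))
             (∑-cong n (λ k → f-sym (suc k) s)) ⟩
      (f s s + ∑ n (f s)) + (∑ n (f s) + ∑ n (λ k → ∑ n (f k)))
        ≡⟨ lemma (f s s) (∑ n (f s)) (∑ n (λ k → ∑ n (f k))) ⟩
      (f s s + + 2 * ∑ n (f s)) + ∑ n (λ k → ∑ n (f k)) ∎
      where
      lemma : ∀ a b c → (a + b) + (b + c) ≡ (a + + 2 * b) + c
      lemma = ℤ-Solver.solve-∀

  theta-∑ : ∀ n f z → theta n f z ≡ f z + + 2 * ∑ n (λ k → ε k * f (z - + (k Nat.* k)))
  theta-∑ zero    f z = sym (ℤₚ.+-identityʳ (f z))
  theta-∑ (suc n) f z = trans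
    (cong (λ x → x + + 2 * (ε (suc n) * f (z - + (suc n Nat.* suc n)))) (theta-∑ n f z))
    (lemma (f z) (∑ n (λ k → ε k * f (z - + (k Nat.* k)))) (ε (suc n) * f (z - + (suc n Nat.* suc n))))
    where
    lemma : ∀ a b c → a + + 2 * b + + 2 * c ≡ a + + 2 * (c + b)
    lemma = ℤ-Solver.solve-∀

  infixl 6 _⊝_

  _⊝_ : ℤ → ℕ → ℤ
  z ⊝ k = z - + (k Nat.* k)

  ⊝-≤ : ∀ {z n} k → z Int.≤ + n → z ⊝ k Int.≤ + n
  ⊝-≤ k = shift-≤ (k Nat.* k)

  S : ℕ → (ℤ → ℤ) → ℤ → ℤ
  S n f z = ∑ n (λ k → ε k * f (z ⊝ k))

  -- Gauss's identity solved for p. The bound n serves every z ≤ n, so it stays fixed while squares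
  -- are subtracted.
  p-recurrence : ∀ n {z} → z Int.≤ + n → p z ≡ δ z + - + 2 * S n p z
  p-recurrence n {z} le = trans (lemma (p z) (S n p z))
    (cong (λ x → x + - + 2 * S n p z) (trans (sym (theta-∑ n p z)) (gauss n le)))
    where
    lemma : ∀ a b → a ≡ (a + + 2 * b) + - + 2 * b
    lemma = ℤ-Solver.solve-∀

  p≈δ : ∀ n {z} → z Int.≤ + n → p z ≈ δ z
  p≈δ n {z} le = subst (_≈ δ z)
    (sym (trans (p-recurrence n le) (lemma (δ z) (S n p z))))
    (+2*-≈ (δ z) (- S n p z))
    where
    lemma : ∀ a b → a + - + 2 * b ≡ a + + 2 * - b
    lemma = ℤ-Solver.solve-∀

  δ-zero : ∀ {z} → z ≢ + 0 → δ z ≡ + 0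
  δ-zero {+ zero}    z≢0 = contradiction refl z≢0
  δ-zero {+ suc _}   _   = refl
  δ-zero { -[1+ _ ]} _   = refl

  -- Equality is asked for only at the shifted arguments that occur, since `p-sum₃` supplies it only
  -- where the δ-term vanishes.
  S-step : ∀ n a {f g : ℤ → ℤ} z → (∀ k → f (z ⊝ suc k) ≡ a * g (z ⊝ suc k)) →
    S n f z ≡ a * S n g z
  S-step n a {f} {g} z eq = trans
    (∑-cong n λ k → trans (cong (ε (suc k) *_) (eq k)) (lemma (ε (suc k)) a (g (z ⊝ suc k))))
    (sym (*-distribˡ-∑ n a (λ k → ε k * g (z ⊝ k))))
    where
    lemma : ∀ e a b → e * (a * b) ≡ a * (e * b)
    lemma = ℤ-Solver.solve-∀

  module _ (n : ℕ) (n≢□+□ : ¬ SumOfTwoSquares n) where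

    +n⊝ : ∀ a b → + n ≢ + (a Nat.* a) + + (b Nat.* b)
    +n⊝ a b eq = n≢□+□ (a , b , ℤₚ.+-injective (trans eq (sym (ℤₚ.pos-+ (a Nat.* a) (b Nat.* b)))))

    p-sum₃ : p (+ n) ≡ - + 8 * S n (S n (S n p)) (+ n)
    p-sum₃ = begin
      p (+ n)
        ≡⟨ step ℤₚ.≤-refl n≢0 ⟩
      - + 2 * S n p (+ n)
        ≡⟨ cong (λ x → - + 2 * x) (S-step n (- + 2) {p} {S n p} (+ n) step₁) ⟩
      - + 2 * (- + 2 * S n (S n p) (+ n))
        ≡⟨ cong (λ x → - + 2 * (- + 2 * x)) (S-step n (- + 2) {S n p} {S n (S n p)} (+ n) λ k →
             S-step n (- + 2) {p} {S n p} (+ n ⊝ suc k) (step₂ k)) ⟩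
      - + 2 * (- + 2 * (- + 2 * S n (S n (S n p)) (+ n)))
        ≡⟨ lemma (S n (S n (S n p)) (+ n)) ⟩
      - + 8 * S n (S n (S n p)) (+ n) ∎
      where
      lemma : ∀ a → - + 2 * (- + 2 * (- + 2 * a)) ≡ - + 8 * a
      lemma = ℤ-Solver.solve-∀
      step : ∀ {z} → z Int.≤ + n → z ≢ + 0 → p z ≡ - + 2 * S n p z
      step {z} le z≢0 = trans (p-recurrence n le)
        (trans (cong (λ x → x + - + 2 * S n p z) (δ-zero z≢0)) (ℤₚ.+-identityˡ (- + 2 * S n p z)))
      -- Zero and squares are sums of two squares with zero summands, so one hypothesis excludes the
      -- δ-term in all three recurrences.
      n≢0 : + n ≢ + 0
      n≢0 eq = +n⊝ 0 0 eq
      n≢k² : ∀ k → + n ⊝ suc k ≢ + 0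
      n≢k² k eq = +n⊝ (suc k) 0 (trans (ℤₚ.i-j≡0⇒i≡j (+ n) k² eq) (sym (ℤₚ.+-identityʳ k²)))
        where
        k² = + (suc k Nat.* suc k)
      n≢k²+l² : ∀ k l → + n ⊝ suc k ⊝ suc l ≢ + 0
      n≢k²+l² k l eq = +n⊝ (suc k) (suc l) (ℤₚ.i-j≡0⇒i≡j (+ n) _
        (trans (lemma′ (+ n) (+ (suc k Nat.* suc k)) (+ (suc l Nat.* suc l))) eq))
        where
        lemma′ : ∀ a b c → a - (b + c) ≡ a - b - c
        lemma′ = ℤ-Solver.solve-∀
      step₁ : ∀ k → p (+ n ⊝ suc k) ≡ - + 2 * S n p (+ n ⊝ suc k)
      step₁ k = step {+ n ⊝ suc k} (⊝-≤ (suc k) ℤₚ.≤-refl) (n≢k² k)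
      step₂ : ∀ k l → p (+ n ⊝ suc k ⊝ suc l) ≡ - + 2 * S n p (+ n ⊝ suc k ⊝ suc l)
      step₂ k l = step {+ n ⊝ suc k ⊝ suc l}
        (⊝-≤ (suc l) (⊝-≤ (suc k) ℤₚ.≤-refl)) (n≢k²+l² k l)

    8∣p̄ : 8 ∣ℕ.∣ p̄ n
    8∣p̄ = ∣ℤ.∣⇒∣ᵤ (subst (+ 8 ∣ℤ_) (sym p-sum₃) (∣ℤ.divides (- s) (lemma s)))
      where
      s = S n (S n (S n p)) (+ n)
      lemma : ∀ s → - + 8 * s ≡ - s * + 8
      lemma = ℤ-Solver.solve-∀

    ⊝⊝⊝ : ∀ x z → + n ⊝ x ⊝ x ⊝ z ≡ + n - + (x Nat.* x Nat.+ x Nat.* x Nat.+ z Nat.* z)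
    ⊝⊝⊝ x z = trans (cong (_⊝ z) (shift₂ (+ n) (x Nat.* x) (x Nat.* x)))
      (shift₂ (+ n) (x Nat.* x Nat.+ x Nat.* x) (z Nat.* z))

    -- δ takes the value 1 exactly at the pairs that `solves? n` keeps.
    ∑-δ : ∀ x m → ∑ m (λ z → δ (+ n ⊝ x ⊝ x ⊝ z)) ≡
      + length (filter (solves? n) (map (x ,_) (range m)))
    ∑-δ x zero    = refl
    ∑-δ x (suc m) with solves? n (x , suc m)
    ... | yes eq = trans
      (cong₂ (λ a b → δ a + b)
        (trans (⊝⊝⊝ x (suc m)) (ℤₚ.i≡j⇒i-j≡0 (cong +_ (sym eq)))) (∑-δ x m))
      (cong (λ ws → + length ws)
        (sym (filter-accept (solves? n) {x , suc m} {map (x ,_) (range m)} eq)))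
    ... | no ¬eq = trans
      (cong₂ _+_ (δ-zero nonzero) (∑-δ x m))
      (trans (ℤₚ.+-identityˡ _) (cong (λ ws → + length ws)
        (sym (filter-reject (solves? n) {x , suc m} {map (x ,_) (range m)} ¬eq))))
      where
      nonzero : + n ⊝ x ⊝ x ⊝ suc m ≢ + 0
      nonzero e = ¬eq (sym (ℤₚ.+-injective
        (ℤₚ.i-j≡0⇒i≡j (+ n) _ (trans (sym (⊝⊝⊝ x (suc m))) e))))

    ∑∑-δ : ∀ l m → ∑ l (λ x → ∑ m (λ z → δ (+ n ⊝ x ⊝ x ⊝ z))) ≡
      + length (filter (solves? n) (cartesianProduct (range l) (range m)))
    ∑∑-δ zero    m = refl
    ∑∑-δ (suc l) m = begin
      ∑ m (λ z → δ (+ n ⊝ suc l ⊝ suc l ⊝ z)) + ∑ l (λ x → ∑ m (λ z → δ (+ n ⊝ x ⊝ x ⊝ z)))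
        ≡⟨ cong₂ _+_ (∑-δ (suc l) m) (∑∑-δ l m) ⟩
      + length (filter (solves? n) us) + + length (filter (solves? n) vs)
        ≡⟨ ℤₚ.pos-+ (length (filter (solves? n) us)) _ ⟨
      + (length (filter (solves? n) us) Nat.+ length (filter (solves? n) vs))
        ≡⟨ cong +_ (length-++ (filter (solves? n) us)) ⟨
      + length (filter (solves? n) us ++ filter (solves? n) vs)
        ≡⟨ cong (λ ws → + length ws) (filter-++ (solves? n) us vs) ⟨
      + length (filter (solves? n) (us ++ vs)) ∎
      where
      us = map (suc l ,_) (range m)
      vs = cartesianProduct (range l) (range m)

    -- By the symmetry in k and l, only the terms with k = l matter modulo 2.
    S₃≈ : S n (S n (S n p)) (+ n) ≈ + length (solutions n)
    S₃≈ = ≈-trans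
      (∑-cong-≈ n λ k → ε*-≈ (suc k) (∑-cong-≈ n λ l → ε*-≈ (suc l) (∑-cong-≈ n λ m → ε*-≈ (suc m)
        (p≈δ n {+ n ⊝ suc k ⊝ suc l ⊝ suc m} (⊝-≤ (suc m) (⊝-≤ (suc l) (⊝-≤ (suc k) ℤₚ.≤-refl)))))))
      (subst (∑ n (λ k → ∑ n (g k)) ≈_) (∑∑-δ n n) (∑-symmetric g g-sym n))
      where
      g : ℕ → ℕ → ℤ
      g k l = ∑ n (λ m → δ (+ n ⊝ k ⊝ l ⊝ m))
      g-sym : ∀ k l → g k l ≡ g l k
      g-sym k l = ∑-cong n λ m → cong (λ z → δ (z ⊝ suc m)) (lemma (+ n) (+ (k Nat.* k)) (+ (l Nat.* l)))
        where
        lemma : ∀ a b c → a - b - c ≡ a - c - b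
        lemma = ℤ-Solver.solve-∀

    16∣p̄ : 2 ∣ℕ.∣ length (solutions n) → 16 ∣ℕ.∣ p̄ n
    16∣p̄ 2∣ = ∣ℤ.∣⇒∣ᵤ (subst (+ 16 ∣ℤ_) (sym p-sum₃)
      (16∣ (∣ℤ.∣m+n∣n⇒∣m (≈⇒∣ S₃≈) (∣ℤ.∣m⇒∣-m (∣ℤ.∣ᵤ⇒∣ 2∣)))))
      where
      16∣ : ∀ {s} → + 2 ∣ℤ s → + 16 ∣ℤ - + 8 * s
      16∣ {s} (∣ℤ.divides q eq) = ∣ℤ.divides (- q) (trans (cong (λ x → - + 8 * x) eq) (lemma q))
        where
        lemma : ∀ q → - + 8 * (q * + 2) ≡ - q * + 16
        lemma = ℤ-Solver.solve-∀

-- Squares modulo 3, and solutions sorted by whether 3 divides x.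

module ModThree where
  open Nat using (_+_; _*_; _^_)
  open ∣ℕ using (_∣_; divides; _∣?_)
  open Forms

  residue : ∀ x → 3 ∣ x ⊎ ∃ λ k → x ≡ 1 + k * 3 ⊎ x ≡ 2 + k * 3
  residue zero    = inj₁ (divides 0 refl)
  residue (suc x) with residue x
  ... | inj₁ (divides k refl) = inj₂ (k , inj₁ refl)
  ... | inj₂ (k , inj₁ refl)  = inj₂ (k , inj₂ refl)
  ... | inj₂ (k , inj₂ refl)  = inj₁ (divides (suc k) refl)

  3∤ : ∀ r k → 0 < r → r < 3 → ¬ 3 ∣ r + k * 3
  3∤ r@(suc _) k _ r<3 3∣ = ∣ℕ.>⇒∤ r<3
    (∣ℕ.∣m+n∣m⇒∣n (subst (3 ∣_) (ℕₚ.+-comm r (k * 3)) 3∣) (∣ℕ.n∣m*n k))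

  square-residue : ∀ x → 3 ∣ x ⊎ ∃ λ k → x * x ≡ 1 + k * 3
  square-residue x with residue x
  ... | inj₁ 3∣x             = inj₁ 3∣x
  ... | inj₂ (k , inj₁ refl) = inj₂ (2 * k + 3 * k * k , lemma k)
    where
    lemma : ∀ k → (1 + k * 3) * (1 + k * 3) ≡ 1 + (2 * k + 3 * k * k) * 3
    lemma = ℕ-Solver.solve-∀
  ... | inj₂ (k , inj₂ refl) = inj₂ (1 + 4 * k + 3 * k * k , lemma k)
    where
    lemma : ∀ k → (2 + k * 3) * (2 + k * 3) ≡ 1 + (1 + 4 * k + 3 * k * k) * 3
    lemma = ℕ-Solver.solve-∀

  3∣square⇒3∣ : ∀ x → 3 ∣ x * x → 3 ∣ x
  3∣square⇒3∣ x 3∣x² with square-residue x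
  ... | inj₁ 3∣x      = 3∣x
  ... | inj₂ (k , eq) = contradiction (subst (3 ∣_) eq 3∣x²) (3∤ 1 k (s≤s z≤n) (s≤s (s≤s z≤n)))

  -- Squares are 0 or 1 modulo 3, so two squares prime to 3 add up to 2.
  3∣□+□⇒3∣ : ∀ x y → 3 ∣ x * x + y * y → 3 ∣ x
  3∣□+□⇒3∣ x y 3∣ with square-residue x | square-residue y
  ... | inj₁ 3∣x      | _        = 3∣x
  ... | inj₂ _        | inj₁ 3∣y = 3∣square⇒3∣ x
    (∣ℕ.∣m+n∣m⇒∣n (subst (3 ∣_) (ℕₚ.+-comm (x * x) (y * y)) 3∣) (∣ℕ.∣m⇒∣m*n y 3∣y))
  ... | inj₂ (k , eq) | inj₂ (l , eq′) = contradiction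
    (subst (3 ∣_) (trans (cong₂ _+_ eq eq′) (lemma k l)) 3∣) (3∤ 2 (k + l) (s≤s z≤n) ℕₚ.≤-refl)
    where
    lemma : ∀ k l → 1 + k * 3 + (1 + l * 3) ≡ 2 + (k + l) * 3
    lemma = ℕ-Solver.solve-∀

  -- Descent: 3 divides x and y, so 9 divides the number. Either a factor 9 can be removed, or a = 0
  -- and 9 ∣ 3m contradicts 3 ∤ m.
  ¬sumOfTwoSquares : ∀ a m → ¬ 3 ∣ m → ¬ SumOfTwoSquares (9 ^ a * (3 * m))
  ¬sumOfTwoSquares a m 3∤m (x , y , eq)
    with 3∣□+□⇒3∣ x y 3∣ | 3∣□+□⇒3∣ y x (subst (3 ∣_) (ℕₚ.+-comm (x * x) (y * y)) 3∣)
    where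
    3∣ : 3 ∣ x * x + y * y
    3∣ = subst (3 ∣_) eq (∣ℕ.∣n⇒∣m*n (9 ^ a) (∣ℕ.m∣m*n m))
  ... | divides x′ refl | divides y′ refl = descend a eq
    where
    descend : ∀ a → 9 ^ a * (3 * m) ≡ x′ * 3 * (x′ * 3) + y′ * 3 * (y′ * 3) → ⊥
    descend zero e = 3∤m (divides (x′ * x′ + y′ * y′)
      (ℕₚ.*-cancelˡ-≡ m _ 3 (trans (sym (ℕₚ.*-identityˡ (3 * m))) (trans e (lemma x′ y′)))))
      where
      lemma : ∀ x y → x * 3 * (x * 3) + y * 3 * (y * 3) ≡ 3 * ((x * x + y * y) * 3)
      lemma = ℕ-Solver.solve-∀
    descend (suc a) e = ¬sumOfTwoSquares a m 3∤m (x′ , y′ , ℕₚ.*-cancelˡ-≡ _ _ 9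
      (trans (sym (ℕₚ.*-assoc 9 (9 ^ a) (3 * m))) (trans e (lemma x′ y′))))
      where
      lemma : ∀ x y → x * 3 * (x * 3) + y * 3 * (y * 3) ≡ 9 * (x * x + y * y)
      lemma = ℕ-Solver.solve-∀

  Positive : ℕ × ℕ → Set
  Positive (x , z) = 0 < x × 0 < z

  box : ℕ → List (ℕ × ℕ)
  box n = cartesianProduct (range n) (range n)

  box-unique : ∀ n → Unique (box n)
  box-unique n = Unique.cartesianProduct⁺ range-unique range-unique
    where
    range-unique : Unique (range n)
    range-unique = Unique.applyDownFrom⁺₁ suc n
      (λ j<i _ eq → ℕₚ.<-irrefl (sym (ℕₚ.suc-injective eq)) j<i)

  ∈-box⁻ : ∀ {n v} → v ∈ box n → Positive v
  ∈-box⁻ {n} v∈ with ∈-cartesianProduct⁻ (range n) (range n) v∈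
  ... | x∈ , z∈ with ∈-applyDownFrom⁻ suc x∈ | ∈-applyDownFrom⁻ suc z∈
  ... | _ , _ , refl | _ , _ , refl = s≤s z≤n , s≤s z≤n

  ∈-range⁺ : ∀ {x n} → 0 < x → x ≤ n → x ∈ range n
  ∈-range⁺ {suc x} _ x<n = ∈-applyDownFrom⁺ suc x<n

  ∈-box⁺ : ∀ {n v} → Positive v → Solves n v → v ∈ box n
  ∈-box⁺ {n} {x@(suc _) , z@(suc _)} (0<x , 0<z) eq = ∈-cartesianProduct⁺
    (∈-range⁺ 0<x (subst (x ≤_) eq (ℕₚ.≤-trans (ℕₚ.m≤m*n x x)
      (ℕₚ.≤-trans (ℕₚ.m≤m+n (x * x) (x * x)) (ℕₚ.m≤m+n _ (z * z))))))
    (∈-range⁺ 0<z (subst (z ≤_) eq (ℕₚ.≤-trans (ℕₚ.m≤m*n z z) (ℕₚ.m≤n+m (z * z) (x * x + x * x)))))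

  -- Testing x suffices: for 3 ∣ n, `3∣x⇒3∣z` and `3∣z⇒3∣x` show that 3 divides both coordinates or
  -- neither.
  Primitive : ℕ → ℕ × ℕ → Set
  Primitive n v = Solves n v × ¬ 3 ∣ proj₁ v

  Imprimitive : ℕ → ℕ × ℕ → Set
  Imprimitive n v = Solves n v × 3 ∣ proj₁ v

  primitive? : ∀ n → Decidable (Primitive n)
  primitive? n v = solves? n v ×-dec ¬? (3 ∣? proj₁ v)

  imprimitive? : ∀ n → Decidable (Imprimitive n)
  imprimitive? n v = solves? n v ×-dec (3 ∣? proj₁ v)

  #primitive : ℕ → ℕ
  #primitive n = length (filter (primitive? n) (box n))

  #imprimitive : ℕ → ℕ
  #imprimitive n = length (filter (imprimitive? n) (box n))

  #solutions : ℕ → ℕ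
  #solutions n = length (solutions n)

  #solutions-split : ∀ n → #solutions n ≡ #primitive n + #imprimitive n
  #solutions-split n = Counting.length-filter-⊎ (solves? n) (primitive? n) (imprimitive? n) (box n)
    (λ {v} _ → mk⇔ (to v) [ proj₁ , proj₁ ]) (λ (_ , 3∤x) (_ , 3∣x) → 3∤x 3∣x)
    where
    to : ∀ v → Solves n v → Primitive n v ⊎ Imprimitive n v
    to (x , z) eq with 3 ∣? x
    ... | yes 3∣x = inj₂ (eq , 3∣x)
    ... | no  3∤x = inj₁ (eq , 3∤x)

  3∣x⇒3∣z : ∀ {n} x z → 3 ∣ n → Solves n (x , z) → 3 ∣ x → 3 ∣ z
  3∣x⇒3∣z x z 3∣n eq 3∣x = 3∣square⇒3∣ z
    (∣ℕ.∣m+n∣m⇒∣n (subst (3 ∣_) (sym eq) 3∣n) (∣ℕ.∣m∣n⇒∣m+n (∣ℕ.∣m⇒∣m*n x 3∣x) (∣ℕ.∣m⇒∣m*n x 3∣x)))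

  -- 2x² is itself a sum of two squares, x² + x², so `3∣□+□⇒3∣` applies to it.
  3∣z⇒3∣x : ∀ {n} x z → 3 ∣ n → Solves n (x , z) → 3 ∣ z → 3 ∣ x
  3∣z⇒3∣x {n} x z 3∣n eq 3∣z = 3∣□+□⇒3∣ x x (∣ℕ.∣m+n∣m⇒∣n
    (subst (3 ∣_) (trans (sym eq) (ℕₚ.+-comm (x * x + x * x) (z * z))) 3∣n) (∣ℕ.∣m⇒∣m*n z 3∣z))

  scale : ∀ x z → x * 3 * (x * 3) + x * 3 * (x * 3) + z * 3 * (z * 3) ≡ 9 * (x * x + x * x + z * z)
  scale = ℕ-Solver.solve-∀

  -- If 3 ∣ x then also 3 ∣ z, and dividing both by 3 divides the form by 9.
  #imprimitive-9* : ∀ n → #imprimitive (9 * n) ≡ #solutions n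
  #imprimitive-9* n = Counting.length-bijective
    (λ v w → v ≡ (proj₁ w * 3 , proj₂ w * 3))
    (λ p q → trans p (sym q))
    (λ {_} {w} {w′} p q → cong₂ _,_
      (ℕₚ.*-cancelʳ-≡ _ _ 3 (cong proj₁ (trans (sym p) q)))
      (ℕₚ.*-cancelʳ-≡ _ _ 3 (cong proj₂ (trans (sym p) q))))
    (Unique.filter⁺ _ (box-unique (9 * n))) (Unique.filter⁺ _ (box-unique n)) to from
    where
    positive/3 : ∀ x → 0 < x * 3 → 0 < x
    positive/3 (suc _) _ = s≤s z≤n
    positive*3 : ∀ x → 0 < x → 0 < x * 3
    positive*3 (suc _) _ = s≤s z≤n
    to : ∀ {v} → v ∈ filter (imprimitive? (9 * n)) (box (9 * n)) →
      ∃ λ w → w ∈ solutions n × v ≡ (proj₁ w * 3 , proj₂ w * 3)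
    to {x , z} v∈ with ∈-filter⁻ (imprimitive? (9 * n)) {xs = box (9 * n)} v∈
    ... | v∈′ , eq , 3∣x
      with ∈-box⁻ {9 * n} v∈′ | 3∣x | 3∣x⇒3∣z x z (∣ℕ.∣m⇒∣m*n n (divides 3 refl)) eq 3∣x
    ... | 0<x , 0<z | divides x′ refl | divides z′ refl =
      (x′ , z′) ,
      ∈-filter⁺ (solves? n) (∈-box⁺ (positive/3 x′ 0<x , positive/3 z′ 0<z) solves) solves ,
      refl
      where
      solves : Solves n (x′ , z′)
      solves = ℕₚ.*-cancelˡ-≡ _ n 9 (trans (sym (scale x′ z′)) eq)
    from : ∀ {w} → w ∈ solutions n →
      ∃ λ v → v ∈ filter (imprimitive? (9 * n)) (box (9 * n)) × v ≡ (proj₁ w * 3 , proj₂ w * 3)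
    from {x , z} w∈ with ∈-filter⁻ (solves? n) {xs = box n} w∈
    ... | w∈′ , eq with ∈-box⁻ {n} w∈′
    ... | 0<x , 0<z = (x * 3 , z * 3) ,
      ∈-filter⁺ (imprimitive? (9 * n))
        (∈-box⁺ (positive*3 x 0<x , positive*3 z 0<z) solves) (solves , divides x refl) ,
      refl
      where
      solves : Solves (9 * n) (x * 3 , z * 3)
      solves = trans (scale x z) (cong (9 *_) eq)

  -- If 3 divides x it divides z, and then 9 ∣ 3m.
  #imprimitive-3* : ∀ m → ¬ 3 ∣ m → #imprimitive (3 * m) ≡ 0
  #imprimitive-3* m 3∤m = cong length (filter-none (imprimitive? (3 * m)) {xs = box (3 * m)}
    (All.tabulate λ {v} _ → none v))
    where
    none : ∀ v → ¬ Imprimitive (3 * m) v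
    none (x , z) (eq , 3∣x) with 3∣x | 3∣x⇒3∣z x z (∣ℕ.m∣m*n m) eq 3∣x
    ... | divides x′ refl | divides z′ refl = 3∤m (divides (x′ * x′ + x′ * x′ + z′ * z′)
      (ℕₚ.*-cancelˡ-≡ m _ 3 (trans (sym eq)
        (trans (scale x′ z′) (lemma (x′ * x′ + x′ * x′ + z′ * z′))))))
      where
      lemma : ∀ a → 9 * a ≡ 3 * (a * 3)
      lemma = ℕ-Solver.solve-∀

-- Multiplication by an element of norm 3 in Z[√-2].

-- Up to sign, z + x√-2 with x, z prime to 3 has z = 1 + 3a and x = 1 + 3b; then
-- multiplication by -(1 + √-2) is (a , b) ↦ (2b - a , -1 - a - b).
module Multiplication where
  open Int using (_+_; _-_; _*_; -_; ∣_∣)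
  open ∣ℕ using (_∣_)
  open Forms
  open ModThree

  u : ℤ → ℤ
  u a = + 1 + + 3 * a

  -- When 3 ∤ x, exactly one of x and -x is 1 modulo 3. So `r` is a bijection from the integers to
  -- the naturals prime to 3, which settles all choices of sign.
  r : ℤ → ℕ
  r a = ∣ u a ∣

  ∣i∣≡∣j∣⇒i≡±j : ∀ {i j} → ∣ i ∣ ≡ ∣ j ∣ → i ≡ j ⊎ i ≡ - j
  ∣i∣≡∣j∣⇒i≡±j {+ m}       {+ .m}       refl = inj₁ refl
  ∣i∣≡∣j∣⇒i≡±j {+ .(suc n)} { -[1+ n ]}  refl = inj₂ refl
  ∣i∣≡∣j∣⇒i≡±j { -[1+ m ]} {+ .(suc m)} refl = inj₂ refl
  ∣i∣≡∣j∣⇒i≡±j { -[1+ m ]} { -[1+ .m ]}  refl = inj₁ refl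

  r-injective : ∀ {a b} → r a ≡ r b → a ≡ b
  r-injective {a} {b} eq with ∣i∣≡∣j∣⇒i≡±j {u a} {u b} eq
  ... | inj₁ e = ℤₚ.*-cancelˡ-≡ (+ 3) a b
    (trans (lemma (+ 3 * a)) (trans (cong (_- + 1) e) (sym (lemma (+ 3 * b)))))
    where
    lemma : ∀ x → x ≡ + 1 + x - + 1
    lemma = ℤ-Solver.solve-∀
  -- Here 1 + 3a = -(1 + 3b), which would give 3 (a + b) = -2.
  ... | inj₂ e = contradiction (∣ℤ.∣⇒∣ᵤ 3∣2) (∣ℕ.>⇒∤ {2} {3} ℕₚ.≤-refl)
    where
    3∣2 : + 3 ∣ℤ + 2
    3∣2 = ∣ℤ.divides (- (a + b)) (trans (lemma (u b))
      (trans (cong (λ x → + 2 - (x + u b)) (sym e)) (lemma′ a b)))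
      where
      lemma : ∀ x → + 2 ≡ + 2 - (- x + x)
      lemma = ℤ-Solver.solve-∀
      lemma′ : ∀ a b → + 2 - ((+ 1 + + 3 * a) + (+ 1 + + 3 * b)) ≡ - (a + b) * + 3
      lemma′ = ℤ-Solver.solve-∀

  pos : ∀ m k → + (m Nat.+ k Nat.* 3) ≡ + m + + k * + 3
  pos m k = trans (ℤₚ.pos-+ m (k Nat.* 3)) (cong (λ x → + m + x) (ℤₚ.pos-* k 3))

  r-surjective : ∀ {x} → ¬ 3 ∣ x → ∃ λ a → r a ≡ x
  r-surjective {x} 3∤x with residue x
  ... | inj₁ 3∣x             = contradiction 3∣x 3∤x
  ... | inj₂ (k , inj₁ refl) = + k , cong ∣_∣ (trans (lemma (+ k)) (sym (pos 1 k)))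
    where
    lemma : ∀ k → + 1 + + 3 * k ≡ + 1 + k * + 3
    lemma = ℤ-Solver.solve-∀
  ... | inj₂ (k , inj₂ refl) = - + suc k , trans (cong ∣_∣ eq) (ℤₚ.∣-i∣≡∣i∣ (+ (2 Nat.+ k Nat.* 3)))
    where
    lemma : ∀ k → + 1 + + 3 * - (+ 1 + k) ≡ - (+ 2 + k * + 3)
    lemma = ℤ-Solver.solve-∀
    eq : u (- + suc k) ≡ - + (2 Nat.+ k Nat.* 3)
    eq = trans (cong (λ x → u (- x)) (ℤₚ.pos-+ 1 k)) (trans (lemma (+ k)) (cong -_ (sym (pos 2 k))))

  3∤r : ∀ a → ¬ 3 ∣ r a
  3∤r a 3∣ = ∣ℕ.>⇒∤ {1} {3} (s≤s (s≤s z≤n)) (∣ℤ.∣⇒∣ᵤ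
    (∣ℤ.∣m+n∣n⇒∣m {m = + 1} {+ 3 * a} (∣ℤ.∣ᵤ⇒∣ 3∣) (∣ℤ.∣m⇒∣m*n {+ 3} {+ 3} a ∣ℤ.∣-refl)))

  r-positive : ∀ a → 0 < r a
  r-positive a with r a | 3∤r a
  ... | zero  | 3∤0 = contradiction (∣ℕ.divides 0 refl) 3∤0
  ... | suc _ | _   = s≤s z≤n

  ∣i∣*∣i∣ : ∀ i → + (∣ i ∣ Nat.* ∣ i ∣) ≡ i * i
  ∣i∣*∣i∣ (+ n)    = ℤₚ.pos-* n n
  ∣i∣*∣i∣ -[1+ n ] = refl

  form : ℤ → ℤ → ℤ
  form a b = u b * u b + u b * u b + u a * u a

  form-r : ∀ a b → + (r b Nat.* r b Nat.+ r b Nat.* r b Nat.+ r a Nat.* r a) ≡ form a b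
  form-r a b = begin
    + (x² Nat.+ x² Nat.+ z²)          ≡⟨ ℤₚ.pos-+ (x² Nat.+ x²) z² ⟩
    + (x² Nat.+ x²) + + z²            ≡⟨ cong (λ y → y + + z²) (ℤₚ.pos-+ x² x²) ⟩
    + x² + + x² + + z²                ≡⟨ cong₂ (λ x z → x + x + z) (∣i∣*∣i∣ (u b)) (∣i∣*∣i∣ (u a)) ⟩
    form a b                          ∎
    where
    open ≡-Reasoning
    x² = r b Nat.* r b
    z² = r a Nat.* r a

  Solves⇒form : ∀ {n} a b → Solves n (r b , r a) → form a b ≡ + n
  Solves⇒form a b eq = trans (sym (form-r a b)) (cong +_ eq)

  form⇒Solves : ∀ {n} a b → form a b ≡ + n → Solves n (r b , r a)
  form⇒Solves a b eq = ℤₚ.+-injective (trans (form-r a b) eq)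

  -- Multiplicativity of the norm z² + 2x², where -(1 + √-2) has norm 3. In `lemma` the definition
  -- of `form` is unfolded so that the solver sees polynomials.
  form-multiply : ∀ a b → form (+ 2 * b - a) (- + 1 - a - b) ≡ + 3 * form a b
  form-multiply = lemma
    where
    lemma : ∀ a b →
      (+ 1 + + 3 * (- + 1 - a - b)) * (+ 1 + + 3 * (- + 1 - a - b)) +
      (+ 1 + + 3 * (- + 1 - a - b)) * (+ 1 + + 3 * (- + 1 - a - b)) +
      (+ 1 + + 3 * (+ 2 * b - a)) * (+ 1 + + 3 * (+ 2 * b - a)) ≡
      + 3 * ((+ 1 + + 3 * b) * (+ 1 + + 3 * b) + (+ 1 + + 3 * b) * (+ 1 + + 3 * b) +
        (+ 1 + + 3 * a) * (+ 1 + + 3 * a))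
    lemma = ℤ-Solver.solve-∀

  -- Division by -(1 + √-2). Always 3 ∣ `form c d`; the second factor 3 makes the coordinates of the
  -- quotient again 1 modulo 3.
  form-divide : ∀ c d m → form c d ≡ + 9 * m → ∃₂ λ a b → c ≡ + 2 * b - a × d ≡ - + 1 - a - b
  form-divide c d m eq = a , b , lemma₁ b c ,
    trans (lemma₂ c d e)
      (trans (cong (λ x → - + 1 - a - b + (x - + 3 * e)) eq′) (lemma₃ (- + 1 - a - b) (+ 3 * e)))
    where
    -- Since `form c d` is 3 (1 + 2c + 4d) + 9 (c² + 2d²), the hypothesis says 1 + 2c + 4d = 3e.
    -- Inverting the map gives 3b = c - d - 1 = 3 (c + d) - (1 + 2c + 4d), hence b = c + d - e.
    e = m - c * c - + 2 * d * d
    b = c + d - e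
    a = + 2 * b - c
    lemma₁ : ∀ b c → c ≡ + 2 * b - (+ 2 * b - c)
    lemma₁ = ℤ-Solver.solve-∀
    lemma₂ : ∀ c d e → d ≡
      - + 1 - (+ 2 * (c + d - e) - c) - (c + d - e) + (+ 1 + + 2 * c + + 4 * d - + 3 * e)
    lemma₂ = ℤ-Solver.solve-∀
    lemma₃ : ∀ x y → x + (y - y) ≡ x
    lemma₃ = ℤ-Solver.solve-∀
    eq′ : + 1 + + 2 * c + + 4 * d ≡ + 3 * e
    eq′ = ℤₚ.*-cancelˡ-≡ (+ 3) _ _ (trans (lemma₄ c d)
      (trans (cong (λ x → x - + 9 * (c * c + + 2 * d * d)) eq) (lemma₅ m (c * c) (+ 2 * d * d))))
      where
      lemma₄ : ∀ c d → + 3 * (+ 1 + + 2 * c + + 4 * d) ≡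
        ((+ 1 + + 3 * d) * (+ 1 + + 3 * d) + (+ 1 + + 3 * d) * (+ 1 + + 3 * d) +
          (+ 1 + + 3 * c) * (+ 1 + + 3 * c))
          - + 9 * (c * c + + 2 * d * d)
      lemma₄ = ℤ-Solver.solve-∀
      lemma₅ : ∀ m x y → + 9 * m - + 9 * (x + y) ≡ + 3 * (+ 3 * (m - x - y))
      lemma₅ = ℤ-Solver.solve-∀

  -- With z and x both 1 modulo 3, z + x√-2 is a multiple of 1 + √-2 but not of 1 - √-2, so its
  -- product with 1 + √-2 is no multiple of 3.
  record _↦_ (v w : ℕ × ℕ) : Set where
    constructor multiply
    field
      a b : ℤ
      source : v ≡ (r b , r a)
      target : w ≡ (r (- + 1 - a - b) , r (+ 2 * b - a))

  ↦-injectiveʳ : ∀ {v w w′} → v ↦ w → v ↦ w′ → w ≡ w′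
  ↦-injectiveʳ (multiply a b refl refl) (multiply a′ b′ eq refl)
    with r-injective {a} {a′} (cong proj₂ eq) | r-injective {b} {b′} (cong proj₁ eq)
  ... | refl | refl = refl

  -- c = 2b - a and d = -1 - a - b give 3b = c - d - 1, and then a = 2b - c.
  ↦-injectiveˡ : ∀ {v v′ w} → v ↦ w → v′ ↦ w → v ≡ v′
  ↦-injectiveˡ (multiply a b refl refl) (multiply a′ b′ refl eq) = cong₂ (λ b a → r b , r a) b≡b′ a≡a′
    where
    c≡ : + 2 * b - a ≡ + 2 * b′ - a′
    c≡ = r-injective (cong proj₂ eq)
    d≡ : - + 1 - a - b ≡ - + 1 - a′ - b′
    d≡ = r-injective (cong proj₁ eq)
    solve-b : ∀ a b → + 3 * b ≡ (+ 2 * b - a) - (- + 1 - a - b) - + 1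
    solve-b = ℤ-Solver.solve-∀
    solve-a : ∀ a b → a ≡ + 2 * b - (+ 2 * b - a)
    solve-a = ℤ-Solver.solve-∀
    b≡b′ : b ≡ b′
    b≡b′ = ℤₚ.*-cancelˡ-≡ (+ 3) b b′ (trans (solve-b a b)
      (trans (cong₂ (λ c d → c - d - + 1) c≡ d≡) (sym (solve-b a′ b′))))
    a≡a′ : a ≡ a′
    a≡a′ = trans (solve-a a b) (trans (cong₂ (λ b c → + 2 * b - c) b≡b′ c≡) (sym (solve-a a′ b′)))

  #primitive-3* : ∀ m → #primitive (3 Nat.* (3 Nat.* m)) ≡ #primitive (3 Nat.* m)
  #primitive-3* m = sym (Counting.length-bijective _↦_ ↦-injectiveˡ ↦-injectiveʳ
    (Unique.filter⁺ _ (box-unique n)) (Unique.filter⁺ _ (box-unique (3 Nat.* n))) to from)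
    where
    n = 3 Nat.* m
    primitive∈ : ∀ k a b → Solves k (r b , r a) → (r b , r a) ∈ filter (primitive? k) (box k)
    primitive∈ k a b eq = ∈-filter⁺ (primitive? k) (∈-box⁺ (r-positive b , r-positive a) eq) (eq , 3∤r b)
    to : ∀ {v} → v ∈ filter (primitive? n) (box n) →
      ∃ λ w → w ∈ filter (primitive? (3 Nat.* n)) (box (3 Nat.* n)) × v ↦ w
    to {x , z} v∈ with ∈-filter⁻ (primitive? n) {xs = box n} v∈
    -- Since 3 ∣ n, z is prime to 3 as well, so both coordinates have a preimage under `r`.
    ... | _ , eq , 3∤x with r-surjective 3∤x | r-surjective (3∤x ∘ 3∣z⇒3∣x x z (∣ℕ.m∣m*n m) eq)
    ... | b , refl | a , refl =
      _ , primitive∈ (3 Nat.* n) c d (form⇒Solves c d form≡) , multiply a b refl refl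
      where
      c = + 2 * b - a
      d = - + 1 - a - b
      form≡ : form c d ≡ + (3 Nat.* n)
      form≡ = trans (form-multiply a b)
        (trans (cong (λ x → + 3 * x) (Solves⇒form a b eq)) (sym (ℤₚ.pos-* 3 n)))
    from : ∀ {w} → w ∈ filter (primitive? (3 Nat.* n)) (box (3 Nat.* n)) →
      ∃ λ v → v ∈ filter (primitive? n) (box n) × v ↦ w
    from {x , z} w∈ with ∈-filter⁻ (primitive? (3 Nat.* n)) {xs = box (3 Nat.* n)} w∈
    ... | _ , eq , 3∤x with r-surjective 3∤x | r-surjective (3∤x ∘ 3∣z⇒3∣x x z (∣ℕ.m∣m*n n) eq)
    ... | d , refl | c , refl
      -- The value here is 3n = 9m, which supplies the factor 9.
      with form-divide c d (+ m) (trans (Solves⇒form c d eq)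
        (trans (cong +_ (sym (ℕₚ.*-assoc 3 3 m))) (ℤₚ.pos-* 9 m)))
    ... | a , b , refl , refl =
      _ , primitive∈ n a b (form⇒Solves a b form≡) , multiply a b refl refl
      where
      form≡ : form a b ≡ + n
      form≡ = ℤₚ.*-cancelˡ-≡ (+ 3) _ _ (trans (sym (form-multiply a b))
        (trans (Solves⇒form c d eq) (ℤₚ.pos-* 3 n)))

-- Parity of the number of solutions.

module Parity where
  open Nat using (_+_; _*_; _^_)
  open ∣ℕ using (_∣_; divides)
  open Forms
  open ModThree
  open Multiplication
  open ≡-Reasoning

  #solutions-9* : ∀ n → #solutions (9 * n) ≡ #primitive (9 * n) + #solutions n
  #solutions-9* n = trans (#solutions-split (9 * n))
    (cong (λ x → #primitive (9 * n) + x) (#imprimitive-9* n))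

  9* : ∀ n → 9 * n ≡ 3 * (3 * n)
  9* = ℕₚ.*-assoc 3 3

  #primitive-9* : ∀ m → #primitive (9 * (3 * m)) ≡ #primitive (3 * m)
  #primitive-9* m = begin
    #primitive (9 * (3 * m))       ≡⟨ cong #primitive (9* (3 * m)) ⟩
    #primitive (3 * (3 * (3 * m))) ≡⟨ #primitive-3* (3 * m) ⟩
    #primitive (3 * (3 * m))       ≡⟨ #primitive-3* m ⟩
    #primitive (3 * m)             ∎

  2∣n+n : ∀ n → 2 ∣ n + n
  2∣n+n n = divides n (trans (cong (λ x → n + x) (sym (ℕₚ.+-identityʳ n))) (ℕₚ.*-comm 2 n))

  -- Each factor 9 adds a primitive count, and the next factor 9 adds the same count again, so two
  -- of them add an even number. In the base case 27m = 9 (3m), the count added equals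
  -- `#solutions (3 * m)`, as all solutions for 3m are primitive.
  2∣#solutions : ∀ k m → ¬ 3 ∣ m → 2 ∣ #solutions (81 ^ k * (27 * m))
  2∣#solutions zero m 3∤m = subst (2 ∣_) (sym eq) (2∣n+n (#primitive (3 * m)))
    where
    eq : #solutions (1 * (27 * m)) ≡ #primitive (3 * m) + #primitive (3 * m)
    eq = begin
      #solutions (1 * (27 * m))
        ≡⟨ cong #solutions (lemma m) ⟩
      #solutions (9 * (3 * m))
        ≡⟨ #solutions-9* (3 * m) ⟩
      #primitive (9 * (3 * m)) + #solutions (3 * m)
        ≡⟨ cong₂ _+_ (#primitive-9* m) (#solutions-split (3 * m)) ⟩
      #primitive (3 * m) + (#primitive (3 * m) + #imprimitive (3 * m))
        ≡⟨ cong (λ x → #primitive (3 * m) + (#primitive (3 * m) + x)) (#imprimitive-3* m 3∤m) ⟩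
      #primitive (3 * m) + (#primitive (3 * m) + 0)
        ≡⟨ cong (λ x → #primitive (3 * m) + x) (ℕₚ.+-identityʳ _) ⟩
      #primitive (3 * m) + #primitive (3 * m)        ∎
      where
      lemma : ∀ m → 1 * (27 * m) ≡ 9 * (3 * m)
      lemma = ℕ-Solver.solve-∀
  2∣#solutions (suc k) m 3∤m = subst (2 ∣_) (sym eq)
    (∣ℕ.∣m∣n⇒∣m+n (2∣n+n (#primitive (9 * n))) (2∣#solutions k m 3∤m))
    where
    n = 81 ^ k * (27 * m)
    eq : #solutions (81 * 81 ^ k * (27 * m)) ≡ #primitive (9 * n) + #primitive (9 * n) + #solutions n
    eq = begin
      #solutions (81 * 81 ^ k * (27 * m))  ≡⟨ cong #solutions (lemma (81 ^ k) m) ⟩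
      #solutions (9 * (9 * n))             ≡⟨ #solutions-9* (9 * n) ⟩
      #primitive (9 * (9 * n)) + #solutions (9 * n) ≡⟨ cong₂ _+_ primitive-eq (#solutions-9* n) ⟩
      #primitive (9 * n) + (#primitive (9 * n) + #solutions n) ≡⟨ ℕₚ.+-assoc (#primitive (9 * n)) _ _ ⟨
      #primitive (9 * n) + #primitive (9 * n) + #solutions n ∎
      where
      lemma : ∀ a m → 81 * a * (27 * m) ≡ 9 * (9 * (a * (27 * m)))
      lemma = ℕ-Solver.solve-∀
      primitive-eq : #primitive (9 * (9 * n)) ≡ #primitive (9 * n)
      primitive-eq = begin
        #primitive (9 * (9 * n))       ≡⟨ cong (λ x → #primitive (9 * x)) (9* n) ⟩
        #primitive (9 * (3 * (3 * n))) ≡⟨ #primitive-9* (3 * n) ⟩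
        #primitive (3 * (3 * n))       ≡⟨ cong #primitive (9* n) ⟨
        #primitive (9 * n)             ∎

-- Powers of 3 in the arguments of the theorem.

module Indices where
  open Nat using (_+_; _*_; _^_; _∸_)
  open ∣ℕ using (_∣_)

  -- With α = `suc β` the truncated subtraction is exact.
  3^[2α∸1] : ∀ β → 3 ^ (2 * suc β ∸ 1) ≡ 3 * 9 ^ β
  3^[2α∸1] β = trans (cong (λ e → 3 ^ (e ∸ 1)) (ℕₚ.*-suc 2 β)) (cong (3 *_) (sym (ℕₚ.^-*-assoc 3 2 β)))

  3^[4α∸1] : ∀ β → 3 ^ (4 * suc β ∸ 1) ≡ 27 * 81 ^ β
  3^[4α∸1] β = begin
    3 ^ (4 * suc β ∸ 1)          ≡⟨ cong (λ e → 3 ^ (e ∸ 1)) (ℕₚ.*-suc 4 β) ⟩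
    3 ^ (3 + 4 * β)              ≡⟨ ℕₚ.^-distribˡ-+-* 3 3 (4 * β) ⟩
    27 * 3 ^ (4 * β)             ≡⟨ cong (27 *_) (ℕₚ.^-*-assoc 3 4 β) ⟨
    27 * 81 ^ β                  ∎
    where open ≡-Reasoning

  factor : ∀ e n c {t} → 3 ^ e ≡ t → 4 * 3 ^ suc e * n + c * 3 ^ e ≡ t * (12 * n + c)
  factor e n c refl = lemma (3 ^ e) n c
    where
    lemma : ∀ t n c → 4 * (3 * t) * n + c * t ≡ t * (12 * n + c)
    lemma = ℕ-Solver.solve-∀

  index₂ : ∀ β n c → 4 * 3 ^ (2 * suc β) * n + c * 3 ^ (2 * suc β ∸ 1) ≡ 9 ^ β * (3 * (12 * n + c))
  -- `2 * suc β` computes to a successor, so `suc (2 * suc β ∸ 1)` equals it definitionally, as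
  -- `factor` requires.
  index₂ β n c = trans (factor (2 * suc β ∸ 1) n c (3^[2α∸1] β)) (lemma (9 ^ β) (12 * n + c))
    where
    lemma : ∀ t m → 3 * t * m ≡ t * (3 * m)
    lemma = ℕ-Solver.solve-∀

  index₄ : ∀ β n c → 4 * 3 ^ (4 * suc β) * n + c * 3 ^ (4 * suc β ∸ 1) ≡ 81 ^ β * (27 * (12 * n + c))
  index₄ β n c = trans (factor (4 * suc β ∸ 1) n c (3^[4α∸1] β)) (lemma (81 ^ β) (12 * n + c))
    where
    lemma : ∀ t m → 27 * t * m ≡ t * (27 * m)
    lemma = ℕ-Solver.solve-∀

  -- Brings the odd exponent 4β + 3 of 3 into the shape of `¬sumOfTwoSquares`.
  81^*27 : ∀ β m → 81 ^ β * (27 * m) ≡ 9 ^ suc (2 * β) * (3 * m)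
  81^*27 β m = trans (lemma (81 ^ β) m) (cong (λ t → 9 * t * (3 * m)) (ℕₚ.^-*-assoc 9 2 β))
    where
    lemma : ∀ t m → t * (27 * m) ≡ 9 * t * (3 * m)
    lemma = ℕ-Solver.solve-∀

  3∤12n+ : ∀ {c} n → ¬ 3 ∣ c → ¬ 3 ∣ 12 * n + c
  3∤12n+ n 3∤c 3∣ = 3∤c (∣ℕ.∣m+n∣m⇒∣n 3∣ (∣ℕ.∣m⇒∣m*n n (∣ℕ.divides 4 refl)))

  8∣p̄-index : ∀ β n c → ¬ 3 ∣ c →
    8 ∣ p̄ (4 * 3 ^ (2 * suc β) * n + c * 3 ^ (2 * suc β ∸ 1))
  8∣p̄-index β n c 3∤c = subst (λ k → 8 ∣ p̄ k) (sym (index₂ β n c))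
    (Congruences.8∣p̄ _ (ModThree.¬sumOfTwoSquares β (12 * n + c) (3∤12n+ n 3∤c)))

  16∣p̄-index : ∀ β n c → ¬ 3 ∣ c →
    16 ∣ p̄ (4 * 3 ^ (4 * suc β) * n + c * 3 ^ (4 * suc β ∸ 1))
  16∣p̄-index β n c 3∤c = subst (λ k → 16 ∣ p̄ k) (sym (index₄ β n c))
    (Congruences.16∣p̄ _
      (subst (λ k → ¬ Forms.SumOfTwoSquares k) (sym (81^*27 β m))
        (ModThree.¬sumOfTwoSquares (suc (2 * β)) m 3∤m))
      (Parity.2∣#solutions β m 3∤m))
    where
    m = 12 * n + c
    3∤m : ¬ 3 ∣ m
    3∤m = 3∤12n+ n 3∤c

-- The congruences modulo 4, 8 and 16.

open import Data.Nat using (ℕ; _+_; _*_; _∸_; _^_; _≤_)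
open import Data.Nat.Divisibility using (_∣_; _∣?_; divides; ∣-trans)
open Indices using (8∣p̄-index; 16∣p̄-index)

theorem4p3 : ∀ (α n i : ℕ) → 1 ≤ α → (i ≡ 1 ⊎ i ≡ 2) →
    (2 ^ 2 ∣ p̄ (4 * 3 ^ (2 * α) * n + (4 * i + 3) * 3 ^ (2 * α ∸ 1)))
    × (2 ^ 3 ∣ p̄ (4 * 3 ^ (2 * α) * n + (4 * i + 6) * 3 ^ (2 * α ∸ 1)))
    × (2 ^ 4 ∣ p̄ (4 * 3 ^ (4 * α) * n + (4 * i + 9) * 3 ^ (4 * α ∸ 1)))
theorem4p3 (suc β) n _ _ (inj₁ refl) =
    -- For i = 1 the coefficients are 7, 10 and 13, all prime to 3. The first value is thus
    -- divisible even by 8, and 4 ∣ 8.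
    ∣-trans (divides 2 refl) (8∣p̄-index β n 7 (from-no (3 ∣? 7)))
  , 8∣p̄-index β n 10 (from-no (3 ∣? 10))
  , 16∣p̄-index β n 13 (from-no (3 ∣? 13))
theorem4p3 (suc β) n _ _ (inj₂ refl) =
    ∣-trans (divides 2 refl) (8∣p̄-index β n 11 (from-no (3 ∣? 11)))
  , 8∣p̄-index β n 14 (from-no (3 ∣? 14))
  , 16∣p̄-index β n 17 (from-no (3 ∣? 17))
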